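{- For every integer $r\ge 2$ there exist constants $c_r>0$ and $m_0(r)$ such that the following holds for every fixed $m\ge m_0(r)$. Let $k=\lceil \frac{m}{r-1}\rceil$. There is a function $\varepsilon(n)\to 0$ as $n\to\infty$ such that for every $n$ there exists a graph $G$ on $n$ vertices with $\alpha_m(G)\ge r$ and $\alpha(G)\le n^{\frac{2+\varepsilon(n)}{k+1-c_r/\sqrt{k}}}$.
   Context: $\alpha(G)$ is the independence number; $\alpha_m(G)\ge r$ means every set of $m$ vertices of $G$ contains an independent set of size $r$. -}

module Defs where

open import Data.Nat using (ℕ; zero; suc; _+_; _*_; _∸_; _^_; _≤_; _<_)
open import Data.Nat.DivMod using (_/_)
open import Data.Fin using (Fin)
open import Data.Fin.Subset using (Subset; _∈_; _⊆_; ∣_∣)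
open import Data.Product using (Σ; _×_)
open import Relation.Binary.PropositionalEquality using (_≡_)
open import Relation.Nullary using (¬_)

ceilDiv : ℕ → ℕ → ℕ
ceilDiv m zero    = 0
ceilDiv m (suc d) = (m + d) / suc d

record Graph (n : ℕ) : Set₁ where
  field
    Adj   : Fin n → Fin n → Set
    sym   : ∀ {i j} → Adj i j → Adj j i
    irrefl : ∀ {i} → ¬ Adj i i

open Graph public

Independent : ∀ {n} → Graph n → Subset n → Set
Independent G S = ∀ {i j} → i ∈ S → j ∈ S → ¬ Adj G i j

AlphaAtLeast : ∀ {n} → Graph n → (m r : ℕ) → Set
AlphaAtLeast {n} G m r =
  (S : Subset n) → ∣ S ∣ ≡ m →
  Σ (Subset n) (λ T → T ⊆ S × Independent G T × ∣ T ∣ ≡ r)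

-- "α(G) ≤ n^(p/q)" for naturals p, q (q ≥ 1), i.e. α(G)^q ≤ n^p:
-- every independent set S satisfies |S|^q ≤ n^p.
AlphaPowLe : ∀ {n} → Graph n → (q p : ℕ) → Set
AlphaPowLe {n} G q p = (S : Subset n) → Independent G S → ∣ S ∣ ^ q ≤ n ^ p

module Submission where

open import Defs hiding (sym)
open import Data.Bool using (Bool; true; false; _∧_; _∨_; not; T?; if_then_else_)
import Data.Bool as Bool
open import Data.Bool.Properties using (T-≡; ∧-zeroʳ)
open import Data.Fin using (Fin; zero; suc; toℕ; combine)
import Data.Fin as Fin
open import Data.Fin.Properties using (all?; any?; combine-injective; toℕ-injective; suc-injective)
open import Data.Fin.Subset using (Subset; inside; outside; ∣_∣) renaming (_∈_ to _∈ˢ_)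
open import Data.Fin.Subset.Properties using (anySubset?; _⊆?_) renaming (_∈?_ to _∈ˢ?_)
open import Data.List using (List; []; _∷_; _++_; length; map; concat; concatMap; take; filter; filterᵇ; tabulate; allFin; upTo)
import Data.List.Membership.DecPropositional as DecMembership
open import Data.List.Membership.Propositional using (_∈_; find; lose)
open import Data.List.Membership.Propositional.Properties
  using ( ∈-map⁺; ∈-map⁻; ∈-++⁺ˡ; ∈-++⁺ʳ; ∈-++⁻; ∈-concat⁺′; ∈-concat⁻′; ∈-concatMap⁺; ∈-concatMap⁻
        ; ∈-filter⁺; ∈-filter⁻; ∈-tabulate⁻; ∈-allFin; ∈-upTo⁺; ∈-upTo⁻ )
open import Data.List.Properties using (length-map; length-++; length-take; length-tabulate; length-upTo; length-filter)
open import Data.List.Relation.Binary.Disjoint.Propositional using (Disjoint)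
open import Data.List.Relation.Binary.Sublist.Propositional using (_⊆_; []; _∷ʳ_; _∷_)
open import Data.List.Relation.Binary.Sublist.Propositional.Properties using (All-resp-⊆)
open import Data.List.Relation.Unary.All as All using (All; []; _∷_)
import Data.List.Relation.Unary.All.Properties as Allₚ
open import Data.List.Relation.Unary.AllPairs using (AllPairs; []; _∷_)
import Data.List.Relation.Unary.AllPairs.Properties as AllPairsₚ
open import Data.List.Relation.Unary.Any as Any using (here; there)
import Data.List.Relation.Unary.Unique.DecPropositional as DecUnique
open import Data.List.Relation.Unary.Unique.Propositional using (Unique)
import Data.List.Relation.Unary.Unique.Propositional.Properties as Uniqueₚ
open import Data.Nat
open import Data.Nat.DivMod using (_/_; m%n<n; m≡m%n+[m/n]*n; m/n*n≤m; m*n/n≡m; /-monoˡ-≤)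
open import Data.Nat.Properties hiding (suc-injective)
open import Data.Nat.Tactic.RingSolver using (solve-∀)
open import Data.Product using (Σ; ∃; ∃₂; _×_; _,_; proj₁; proj₂)
open import Data.Sum using (_⊎_; inj₁; inj₂; [_,_])
open import Data.Vec as Vec using (Vec; []; _∷_; lookup; _[_]≔_)
open import Data.Vec.Functional using (updateAt) renaming (_∷_ to _∷ᶠ_)
open import Data.Vec.Functional.Properties using (updateAt-updates; updateAt-minimal)
open import Data.Vec.Properties using (lookup∘update′; lookup∘tabulate; []=⇒lookup; lookup⇒[]=)
open import Function using (_∘_)
open import Function.Bundles using (Equivalence)
open import Relation.Binary.Definitions using (DecidableEquality)
open import Relation.Binary.PropositionalEquality hiding (J; [_])
open import Relation.Nullary using (¬_; Dec; yes; no; does; contradiction)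
open import Relation.Nullary.Decidable using (_×-dec_; _→-dec_; ¬?; map′)

-- With R = r − 1, a graph U on R(k − 1) + 1 vertices without independent sets of size R + 1 contains a subgraph W of density
-- (e − 1)/(w − 2) ≥ (k + 1 − t)/2 with t = O(1/√k): a vertex of degree at most k − 2 can be removed with its neighbourhood, and
-- otherwise, unless U itself is dense, U is up to O(1) vertices a union of R cliques, and each left-over vertex is joined to all
-- but O(√k) vertices of one of them. Adding it there gives R parts, one with at least k vertices, lacking only O(√k) edges.
--
-- Such dense subgraphs are destroyed in a random graph of edge probability slightly below n^(−2/(k + 1 − t)) by deleting the
-- edges of a maximal edge-disjoint family of them (Erdős, Krivelevich). A set of s = n^(2/(k + 1 − t) + o(1)) vertices keeps an
-- edge, since it has many edges and few members of such a family meet it. Since all error terms are powers of n, union bounds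
-- over integer weights suffice.

-- The density (e - 1)/(w - 2) counts copies through one edge: with edge probability 1/q there are
-- n^(w-2) choices of the other vertices, each of probability q^(1-e), and an s-set loses few edges
-- once the product is small. A k-clique has 2(e - 1)/(w - 2) = k + 1 exactly, and each ordered
-- non-adjacent pair among k vertices lowers this by 1/(k - 2); hence t is about `defect` / k. The
-- √k is a balance. If `U` is not dense, closed degrees are at least k and at most k + 2 on average,
-- so O(k/h) vertices have degree k + h or more. These, and O(h) stray neighbours of the others, are
-- all that can separate a left-over vertex from every clique, and h ≈ √k minimises h + k/h. The
-- obstacle in the random part is the upper tail of the number of copies meeting an s-set, since it
-- has to beat n^(-s) while copies sharing edges are dependent. Members of a disjoint family are
-- independent, so the expected number of J-subfamilies is at most μ^J/J!. Reals are avoided: t is a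
-- fraction u/v, τ/v is k + 1 - t, expectations carry a power of q, and n is compared with powers of
-- an integer z ≈ n^(1/D).

-- A linear-arithmetic certificate: a ≤ b follows from x ≤ y once the (ring-solvable) identity is checked, with slack c.
≤-cert : ∀ {x y a b} c → x ≤ y → a + y + c ≡ b + x → a ≤ b
≤-cert {x} {y} {a} {b} c x≤y eq = +-cancelʳ-≤ y a b (begin
  a + y      ≤⟨ m≤m+n (a + y) c ⟩
  a + y + c  ≡⟨ eq ⟩
  b + x      ≤⟨ +-monoʳ-≤ b x≤y ⟩
  b + y      ∎)
  where open ≤-Reasoning

-- Counting with sums over lists

⟦_⟧ : Bool → ℕ
⟦ true ⟧  = 1
⟦ false ⟧ = 0

⟦b⟧≤1 : ∀ b → ⟦ b ⟧ ≤ 1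
⟦b⟧≤1 true  = ≤-refl
⟦b⟧≤1 false = z≤n

false≢true : false ≢ true
false≢true ()

≤ᵇ-true : ∀ {m n} → m ≤ n → (m ≤ᵇ n) ≡ true
≤ᵇ-true m≤n = Equivalence.to T-≡ (≤⇒≤ᵇ m≤n)

≤ᵇ-true⁻¹ : ∀ {m n} → (m ≤ᵇ n) ≡ true → m ≤ n
≤ᵇ-true⁻¹ {m} eq = ≤ᵇ⇒≤ m _ (Equivalence.from T-≡ eq)

∧-true : ∀ {a b} → a ∧ b ≡ true → a ≡ true × b ≡ true
∧-true {true} {true} refl = refl , refl

∑ : {A : Set} → List A → (A → ℕ) → ℕ
∑ []       f = 0
∑ (x ∷ xs) f = f x + ∑ xs f

module _ {A : Set} where

  ∑-mono : ∀ (xs : List A) {f g} → (∀ {x} → x ∈ xs → f x ≤ g x) → ∑ xs f ≤ ∑ xs g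
  ∑-mono []       f≤g = z≤n
  ∑-mono (x ∷ xs) f≤g = +-mono-≤ (f≤g (here refl)) (∑-mono xs (f≤g ∘ there))

  ∑-cong : ∀ (xs : List A) {f g} → (∀ {x} → x ∈ xs → f x ≡ g x) → ∑ xs f ≡ ∑ xs g
  ∑-cong []       f≡g = refl
  ∑-cong (x ∷ xs) f≡g = cong₂ _+_ (f≡g (here refl)) (∑-cong xs (f≡g ∘ there))

  ∑-+ : ∀ (xs : List A) f g → ∑ xs (λ x → f x + g x) ≡ ∑ xs f + ∑ xs g
  ∑-+ []       f g = refl
  ∑-+ (x ∷ xs) f g = trans (cong (f x + g x +_) (∑-+ xs f g)) (rearrange (f x) (g x) (∑ xs f) (∑ xs g))
    where
    rearrange : ∀ a b c d → a + b + (c + d) ≡ a + c + (b + d)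
    rearrange = solve-∀

  ∑-* : ∀ (xs : List A) c f → ∑ xs (λ x → c * f x) ≡ c * ∑ xs f
  ∑-* []       c f = sym (*-zeroʳ c)
  ∑-* (x ∷ xs) c f = trans (cong (c * f x +_) (∑-* xs c f)) (sym (*-distribˡ-+ c (f x) (∑ xs f)))

  ∑-const : ∀ (xs : List A) c → ∑ xs (λ _ → c) ≡ length xs * c
  ∑-const []       c = refl
  ∑-const (x ∷ xs) c = cong (c +_) (∑-const xs c)

  ∑-1 : ∀ (xs : List A) → ∑ xs (λ _ → 1) ≡ length xs
  ∑-1 xs = trans (∑-const xs 1) (*-identityʳ (length xs))

  ∑-++ : ∀ (xs ys : List A) f → ∑ (xs ++ ys) f ≡ ∑ xs f + ∑ ys f
  ∑-++ []       ys f = refl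
  ∑-++ (x ∷ xs) ys f = trans (cong (f x +_) (∑-++ xs ys f)) (sym (+-assoc (f x) (∑ xs f) (∑ ys f)))

  ∑-take : ∀ k (xs : List A) f → ∑ (take k xs) f ≤ ∑ xs f
  ∑-take zero    xs       f = z≤n
  ∑-take (suc k) []       f = z≤n
  ∑-take (suc k) (x ∷ xs) f = +-monoʳ-≤ (f x) (∑-take k xs f)

  ∑-filterᵇ : ∀ p (xs : List A) f → ∑ (filterᵇ p xs) f ≡ ∑ xs (λ x → ⟦ p x ⟧ * f x)
  ∑-filterᵇ p []       f = refl
  ∑-filterᵇ p (x ∷ xs) f with p x
  ... | true  = cong₂ _+_ (sym (+-identityʳ (f x))) (∑-filterᵇ p xs f)
  ... | false = ∑-filterᵇ p xs f

  ∑-filterᵇ≤ : ∀ p (xs : List A) f → ∑ (filterᵇ p xs) f ≤ ∑ xs f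
  ∑-filterᵇ≤ p xs f = begin
    ∑ (filterᵇ p xs) f            ≡⟨ ∑-filterᵇ p xs f ⟩
    ∑ xs (λ x → ⟦ p x ⟧ * f x)    ≤⟨ ∑-mono xs (λ {x} _ → ≤-trans (*-monoˡ-≤ (f x) (⟦b⟧≤1 (p x))) (≤-reflexive (*-identityˡ (f x)))) ⟩
    ∑ xs f                        ∎
    where open ≤-Reasoning

  length-filterᵇ : ∀ p (xs : List A) → length (filterᵇ p xs) ≡ ∑ xs (⟦_⟧ ∘ p)
  length-filterᵇ p []       = refl
  length-filterᵇ p (x ∷ xs) with p x
  ... | true  = cong suc (length-filterᵇ p xs)
  ... | false = length-filterᵇ p xs

  ∈-filterᵇ⁺ : ∀ p {x} {xs : List A} → x ∈ xs → p x ≡ true → x ∈ filterᵇ p xs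
  ∈-filterᵇ⁺ p x∈xs px = ∈-filter⁺ (T? ∘ p) x∈xs (Equivalence.from T-≡ px)

  ∈-filterᵇ⁻ : ∀ p {x} {xs : List A} → x ∈ filterᵇ p xs → x ∈ xs × p x ≡ true
  ∈-filterᵇ⁻ p x∈f = let x∈xs , px = ∈-filter⁻ (T? ∘ p) x∈f in x∈xs , Equivalence.to T-≡ px

  ∑-0 : ∀ (xs : List A) → ∑ xs (λ _ → 0) ≡ 0
  ∑-0 xs = trans (∑-const xs 0) (*-zeroʳ (length xs))

  ∈⇒≤∑ : ∀ {xs : List A} {x} f → x ∈ xs → f x ≤ ∑ xs f
  ∈⇒≤∑ {_ ∷ xs} f (here refl) = m≤m+n (f _) (∑ xs f)
  ∈⇒≤∑ {y ∷ xs} f (there x∈)  = ≤-trans (∈⇒≤∑ f x∈) (m≤n+m (∑ xs f) (f y))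

  ∑-pigeonhole : ∀ (xs : List A) f c → length xs * c < ∑ xs f → ∃ λ x → x ∈ xs × c < f x
  ∑-pigeonhole (x ∷ xs) f c lt with c <? f x
  ... | yes c<fx = x , here refl , c<fx
  ... | no  c≮fx =
    let y , y∈ , c<fy = ∑-pigeonhole xs f c (+-cancelˡ-< c _ _ (<-≤-trans lt (+-monoˡ-≤ (∑ xs f) (≮⇒≥ c≮fx))))
    in y , there y∈ , c<fy

module _ {A B : Set} where

  ∑-swap : ∀ (xs : List A) (ys : List B) (f : A → B → ℕ) →
           ∑ xs (λ x → ∑ ys (λ y → f x y)) ≡ ∑ ys (λ y → ∑ xs (λ x → f x y))
  ∑-swap []       ys f = sym (∑-0 ys)
  ∑-swap (x ∷ xs) ys f = trans (cong (∑ ys (f x) +_) (∑-swap xs ys f)) (sym (∑-+ ys (f x) _))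

  ∑-map : ∀ (h : A → B) xs f → ∑ (map h xs) f ≡ ∑ xs (f ∘ h)
  ∑-map h []       f = refl
  ∑-map h (x ∷ xs) f = cong (f (h x) +_) (∑-map h xs f)

  ∑-concatMap : ∀ (h : A → List B) xs f → ∑ (concatMap h xs) f ≡ ∑ xs (λ x → ∑ (h x) f)
  ∑-concatMap h []       f = refl
  ∑-concatMap h (x ∷ xs) f = trans (∑-++ (h x) _ f) (cong (∑ (h x) f +_) (∑-concatMap h xs f))

module _ {A : Set} (_≟_ : DecidableEquality A) where

  ∑-point≤1 : ∀ x {xs} → Unique xs → ∑ xs (λ y → ⟦ does (x ≟ y) ⟧) ≤ 1
  ∑-point≤1 x {[]}     []        = z≤n
  ∑-point≤1 x {y ∷ xs} (y∉ ∷ u) with x ≟ y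
  ... | no  _    = ∑-point≤1 x u
  ... | yes refl = ≤-reflexive (cong suc (trans (∑-cong xs off) (∑-0 xs)))
    where
    off : ∀ {y} → y ∈ xs → ⟦ does (x ≟ y) ⟧ ≡ 0
    off {y} y∈ with x ≟ y
    ... | yes refl = contradiction refl (All.lookup y∉ y∈)
    ... | no  _    = refl

  ∑-point≥1 : ∀ {x xs} → x ∈ xs → 1 ≤ ∑ xs (λ y → ⟦ does (x ≟ y) ⟧)
  ∑-point≥1 {x} x∈ = ≤-trans (≤-reflexive (sym point)) (∈⇒≤∑ (λ y → ⟦ does (x ≟ y) ⟧) x∈)
    where
    point : ⟦ does (x ≟ x) ⟧ ≡ 1
    point with x ≟ x
    ... | yes _ = refl
    ... | no ¬r = contradiction refl ¬r

  -- Double counting of equal pairs: every entry of `xs` has a partner in `ys`, and every entry of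
  -- `ys` has at most one in `xs`.
  length-⊆ : ∀ {xs ys} → Unique xs → (∀ {x} → x ∈ xs → x ∈ ys) → length xs ≤ length ys
  length-⊆ {xs} {ys} u xs⊆ys = begin
    length xs                                   ≡⟨ ∑-1 xs ⟨
    ∑ xs (λ _ → 1)                              ≤⟨ ∑-mono xs (λ x∈ → ∑-point≥1 (xs⊆ys x∈)) ⟩
    ∑ xs (λ x → ∑ ys (λ y → ⟦ does (x ≟ y) ⟧))  ≡⟨ ∑-swap xs ys (λ x y → ⟦ does (x ≟ y) ⟧) ⟩
    ∑ ys (λ y → ∑ xs (λ x → ⟦ does (x ≟ y) ⟧))  ≤⟨ ∑-mono ys (λ {y} _ → ≤-trans (≤-reflexive (∑-cong xs (λ {x} _ → flip-does x y))) (∑-point≤1 y u)) ⟩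
    ∑ ys (λ _ → 1)                              ≡⟨ ∑-1 ys ⟩
    length ys                                   ∎
    where
    open ≤-Reasoning
    flip-does : ∀ x y → ⟦ does (x ≟ y) ⟧ ≡ ⟦ does (y ≟ x) ⟧
    flip-does x y with x ≟ y | y ≟ x
    ... | yes _ | yes _ = refl
    ... | no  _ | no  _ = refl
    ... | yes p | no ¬p = contradiction (sym p) ¬p
    ... | no ¬p | yes p = contradiction (sym p) ¬p

∈-take : ∀ {A : Set} n {xs : List A} {x} → x ∈ take n xs → x ∈ xs
∈-take (suc n) {_ ∷ _} (here e)   = here e
∈-take (suc n) {_ ∷ _} (there x∈) = there (∈-take n x∈)

length-take-≤ : ∀ {A : Set} n (xs : List A) → n ≤ length xs → length (take n xs) ≡ n
length-take-≤ n xs n≤ = trans (length-take n xs) (m≤n⇒m⊓n≡m n≤)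

nonempty : ∀ {A : Set} (xs : List A) → 0 < length xs → ∃ (_∈ xs)
nonempty (x ∷ xs) _ = x , here refl

not-true : ∀ {b} → not b ≡ true → b ≡ false
not-true {false} _ = refl

≤ᵇ-false⁻¹ : ∀ {m n} → (m ≤ᵇ n) ≡ false → n < m
≤ᵇ-false⁻¹ {m} {n} eq = ≰⇒> λ m≤n → false≢true (trans (sym eq) (≤ᵇ-true m≤n))

⟦⟧-split : ∀ b → 1 ≡ ⟦ b ⟧ + ⟦ not b ⟧
⟦⟧-split true  = refl
⟦⟧-split false = refl

length-filterᵇ-not : ∀ {A : Set} p (xs : List A) →
                     length xs ≡ ∑ xs (⟦_⟧ ∘ p) + length (filterᵇ (not ∘ p) xs)
length-filterᵇ-not p xs = begin
  length xs                                               ≡⟨ ∑-1 xs ⟨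
  ∑ xs (λ _ → 1)                                          ≡⟨ ∑-cong xs (λ {y} _ → ⟦⟧-split (p y)) ⟩
  ∑ xs (λ y → ⟦ p y ⟧ + ⟦ not (p y) ⟧)                    ≡⟨ ∑-+ xs _ _ ⟩
  ∑ xs (⟦_⟧ ∘ p) + ∑ xs (λ y → ⟦ not (p y) ⟧)             ≡⟨ cong (∑ xs (⟦_⟧ ∘ p) +_) (length-filterᵇ (not ∘ p) xs) ⟨
  ∑ xs (⟦_⟧ ∘ p) + length (filterᵇ (not ∘ p) xs)          ∎
  where open ≡-Reasoning

-- Dense subgraphs of graphs without large independent sets

-- Bounds, for at most R parts: leftover on the number of vertices outside the cliques, missing on the number of vertices of its
-- clique to which a leftover vertex is not joined (h ≈ √k), defect on the ordered non-adjacent pairs in a part.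
leftover : ℕ → ℕ
leftover R = R * (5 * R)

missing : ℕ → ℕ → ℕ
missing R h = 2 * R * suc h + R * (suc h + leftover R)

defect : ℕ → ℕ → ℕ
defect R h = 2 * (leftover R * missing R h) + leftover R * leftover R

-- nb x y stands for "x = y or x is adjacent to y".
module Neighbourhoods {A : Set} (nb : A → A → Bool)
  (nb-refl : ∀ x → nb x x ≡ true) (nb-sym : ∀ x y → nb x y ≡ nb y x) where

  -- A vertex of `xs` counts itself, so in a clique on k vertices the value is k; all degree bounds
  -- below are in this unit.
  cdeg : List A → A → ℕ
  cdeg xs x = ∑ xs (λ y → ⟦ nb x y ⟧)

  cdegSum : List A → ℕ
  cdegSum xs = ∑ xs (cdeg xs)

  Indep : ∀ {l} → (Fin l → A) → Set
  Indep z = ∀ i j → i ≢ j → nb (z i) (z j) ≡ false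

  HasIndep : ℕ → List A → Set
  HasIndep l U = Σ (Fin l → A) λ z → (∀ i → z i ∈ U) × Indep z

  indep-∷ : ∀ {l x} {z : Fin l → A} → (∀ i → nb x (z i) ≡ false) → Indep z → Indep (x ∷ᶠ z)
  indep-∷ x-z ind zero    zero    0≢0 = contradiction refl 0≢0
  indep-∷ x-z ind zero    (suc j) _   = x-z j
  indep-∷ x-z ind (suc i) zero    _   = trans (nb-sym _ _) (x-z i)
  indep-∷ x-z ind (suc i) (suc j) i≢j = ind i j (i≢j ∘ cong suc)

  hasIndep-∷ : ∀ {l x} {z : Fin l → A} {U} → x ∈ U → (∀ i → z i ∈ U) →
               (∀ i → nb x (z i) ≡ false) → Indep z → HasIndep (suc l) U
  hasIndep-∷ {x = x} {z} x∈ z∈ x-z ind = x ∷ᶠ z , (λ { zero → x∈ ; (suc i) → z∈ i }) , indep-∷ x-z ind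

  indep-updateAt : ∀ {l i y} {z : Fin l → A} → (∀ j → j ≢ i → nb y (z j) ≡ false) →
                   Indep z → Indep (updateAt z i (λ _ → y))
  indep-updateAt {i = i} {y} {z} y-z ind a b a≢b with a Fin.≟ i | b Fin.≟ i
  ... | yes refl | yes refl = contradiction refl a≢b
  ... | yes refl | no b≢i   = trans (cong₂ nb (updateAt-updates i z) (updateAt-minimal b i z b≢i)) (y-z b b≢i)
  ... | no a≢i   | yes refl = trans (cong₂ nb (updateAt-minimal a i z a≢i) (updateAt-updates i z)) (trans (nb-sym _ _) (y-z a a≢i))
  ... | no a≢i   | no b≢i   = trans (cong₂ nb (updateAt-minimal a i z a≢i) (updateAt-minimal b i z b≢i)) (ind a b a≢b)

  nonNeighbours : A → List A → List A
  nonNeighbours x = filterᵇ (not ∘ nb x)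

  -- Choosing a vertex deletes its at most `B` closed neighbours from every later list, so a list
  -- suffers at most `pred l` such deletions before its turn. Equal lists give independent vertices
  -- of low degree; the lists `P i` may also be parts of different cliques.
  greedy-transversal : ∀ l B (P : Fin l → List A) →
    (∀ i j → i ≢ j → ∀ {x} → x ∈ P i → cdeg (P j) x ≤ B) →
    (∀ j → pred l * B < length (P j)) →
    Σ (Fin l → A) λ z → (∀ i → z i ∈ P i) × Indep z
  greedy-transversal zero    B P few large = (λ ()) , (λ ()) , λ ()
  greedy-transversal (suc l) B P few large =
    let x , x∈         = nonempty (P zero) (≤-<-trans z≤n (large zero))
        P′             = λ j → nonNeighbours x (P (suc j))
        z , z∈ , indep = greedy-transversal l B P′
          (λ i j i≢j y∈ → ≤-trans (∑-filterᵇ≤ (not ∘ nb x) (P (suc j)) _)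
                                  (few (suc i) (suc j) (i≢j ∘ λ { refl → refl }) (proj₁ (∈-filterᵇ⁻ _ y∈))))
          (λ j → shrunk l x (P (suc j)) j (few zero (suc j) (λ ()) x∈) (large (suc j)))
    in  x ∷ᶠ z
      , (λ { zero → x∈ ; (suc i) → proj₁ (∈-filterᵇ⁻ _ (z∈ i)) })
      , indep-∷ (λ i → not-true (proj₂ (∈-filterᵇ⁻ (not ∘ nb x) {xs = P (suc i)} (z∈ i)))) indep
    where
    shrunk : ∀ l x Q → Fin l → cdeg Q x ≤ B → l * B < length Q → pred l * B < length (nonNeighbours x Q)
    shrunk (suc l) x Q _ d≤B lt = +-cancelˡ-< B _ _ (<-≤-trans lt (begin
      length Q                          ≡⟨ length-filterᵇ-not (nb x) Q ⟩
      cdeg Q x + length (nonNeighbours x Q)   ≤⟨ +-monoˡ-≤ _ d≤B ⟩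
      B + length (nonNeighbours x Q)          ∎))
      where open ≤-Reasoning

  -- Markov's inequality for the excess of the closed degree over `k`, which is nonnegative and sums
  -- to at most `2 * length U`.
  markov : ∀ U k → (∀ {x} → x ∈ U → k ≤ cdeg U x) → cdegSum U ≤ (k + 2) * length U →
           ∀ h → h * ∑ U (λ x → ⟦ k + h ≤ᵇ cdeg U x ⟧) ≤ 2 * length U
  markov U k minDeg avgDeg h = ≤-cert 0 (begin
    h * ∑ U high + length U * k     ≡⟨ cong₂ _+_ (sym (∑-* U h high)) (sym (∑-const U k)) ⟩
    ∑ U (λ x → h * high x) + ∑ U (λ _ → k)  ≡⟨ ∑-+ U _ _ ⟨
    ∑ U (λ x → h * high x + k)      ≤⟨ ∑-mono U pointwise ⟩
    cdegSum U                       ≤⟨ avgDeg ⟩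
    (k + 2) * length U              ∎)
    (eq (h * ∑ U high) k (length U))
    where
    open ≤-Reasoning
    high : A → ℕ
    high x = ⟦ k + h ≤ᵇ cdeg U x ⟧
    eq : ∀ a k n → a + (k + 2) * n + 0 ≡ 2 * n + (a + n * k)
    eq = solve-∀
    pointwise : ∀ {x} → x ∈ U → h * high x + k ≤ cdeg U x
    pointwise {x} x∈ with k + h ≤ᵇ cdeg U x in eq
    ... | true  = ≤-trans (≤-reflexive (trans (cong (_+ k) (*-identityʳ h)) (+-comm h k))) (≤ᵇ-true⁻¹ eq)
    ... | false = ≤-trans (≤-reflexive (cong (_+ k) (*-zeroʳ h))) (minDeg x∈)

  module Structure (R k′ ℓ h : ℕ) (U : List A)
    (size : length U ≡ ℓ * k′ + 1)
    (0<ℓ : 0 < ℓ) (ℓ≤R : ℓ ≤ R)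
    (noIndep : ¬ HasIndep (suc ℓ) U)
    (minDeg : ∀ {x} → x ∈ U → suc k′ ≤ cdeg U x)
    (avgDeg : cdegSum U ≤ (suc k′ + 2) * length U)
    (k-large : 10 * (R * R) < suc k′)
    (k≤h² : suc k′ ≤ suc h * suc h)
    where

    k = suc k′
    Λ = leftover R
    q = missing R h

    open ≤-Reasoning

    high : ℕ → A → Bool
    high d x = k + d ≤ᵇ cdeg U x

    |U|≤Rk : length U ≤ R * k
    |U|≤Rk = begin
      length U      ≡⟨ size ⟩
      ℓ * k′ + 1    ≤⟨ +-monoʳ-≤ (ℓ * k′) 0<ℓ ⟩
      ℓ * k′ + ℓ    ≡⟨ eq ℓ k′ ⟩
      ℓ * k         ≤⟨ *-monoˡ-≤ k ℓ≤R ⟩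
      R * k         ∎
      where
      eq : ∀ a b → a * b + a ≡ a * suc b
      eq = solve-∀

    0<R : 0 < R
    0<R = ≤-trans 0<ℓ ℓ≤R

    few-high : ∀ d → d * ∑ U (λ x → ⟦ high d x ⟧) ≤ 2 * (R * k)
    few-high d = ≤-trans (markov U k minDeg avgDeg d) (*-monoʳ-≤ 2 |U|≤Rk)

    -- The excess `4 * R` is chosen so that Markov's bound 2Rk / (4R) is half of k.
    few-high₁ : 2 * ∑ U (λ x → ⟦ high (4 * R) x ⟧) ≤ k
    few-high₁ = *-cancelˡ-≤ (2 * R) ⦃ m*n≢0 2 R ⦃ _ ⦄ ⦃ >-nonZero 0<R ⦄ ⦄ (begin
      2 * R * (2 * n)   ≡⟨ eq₁ R n ⟩
      4 * R * n         ≤⟨ few-high (4 * R) ⟩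
      2 * (R * k)       ≡⟨ *-assoc 2 R k ⟨
      2 * R * k         ∎)
      where
      n = ∑ U (λ x → ⟦ high (4 * R) x ⟧)
      eq₁ : ∀ r n → 2 * r * (2 * n) ≡ 4 * r * n
      eq₁ = solve-∀

    -- At an excess of about √k the bound 2Rk / (h + 1) becomes linear in `h`.
    few-high₂ : ∑ U (λ x → ⟦ high (suc h) x ⟧) ≤ 2 * R * suc h
    few-high₂ = *-cancelˡ-≤ (suc h) (begin
      suc h * ∑ U (λ x → ⟦ high (suc h) x ⟧)  ≤⟨ few-high (suc h) ⟩
      2 * (R * k)                             ≤⟨ *-monoʳ-≤ 2 (*-monoʳ-≤ R k≤h²) ⟩
      2 * (R * (suc h * suc h))               ≡⟨ eq R (suc h) ⟩
      suc h * (2 * R * suc h)                 ∎)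
      where
      eq : ∀ r h → 2 * (r * (h * h)) ≡ h * (2 * r * h)
      eq = solve-∀

    low : List A
    low = filterᵇ (not ∘ high (4 * R)) U

    low-deg : ∀ {x} → x ∈ low → cdeg U x ≤ k + 4 * R
    low-deg x∈ = <⇒≤ (≤ᵇ-false⁻¹ (not-true (proj₂ (∈-filterᵇ⁻ (not ∘ high (4 * R)) {xs = U} x∈))))

    4R+1≤5R : 4 * R + 1 ≤ 5 * R
    4R+1≤5R = ≤-trans (+-monoʳ-≤ (4 * R) 0<R) (≤-reflexive (eq R))
      where
      eq : ∀ r → 4 * r + r ≡ 5 * r
      eq = solve-∀

    -- After the loss of k/2 vertices the surplus over (ℓ - 1)(k + 4R) is at least k/2 - (ℓ - 1)(4R
    -- + 1), and the subtracted term is at most 5R². This is where `10 * (R * R) < suc k′` comes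
    -- from.
    low-large : pred ℓ * (k + 4 * R) < length low
    low-large = *-cancelˡ-< 2 _ _ (≤-cert 0
      (+-mono-≤ few-high₁ (+-mono-≤ k-large (+-mono-≤ slack (*-monoʳ-≤ 2 (≤-reflexive split)))))
      (eq l k′ R n (length low)))
      where
      l = pred ℓ
      n = ∑ U (λ x → ⟦ high (4 * R) x ⟧)
      split : suc l * k′ + 1 ≡ n + length low
      split = trans (cong (λ m → m * k′ + 1) (suc-pred ℓ ⦃ >-nonZero 0<ℓ ⦄))
                    (trans (sym size) (length-filterᵇ-not (high (4 * R)) U))
      slack : 2 * (l * (4 * R + 1)) ≤ 10 * (R * R)
      slack = begin
        2 * (l * (4 * R + 1))  ≤⟨ *-monoʳ-≤ 2 (*-mono-≤ (≤-trans pred[n]≤n ℓ≤R) 4R+1≤5R) ⟩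
        2 * (R * (5 * R))      ≡⟨ eq′ R ⟩
        10 * (R * R)           ∎
        where
        eq′ : ∀ r → 2 * (r * (5 * r)) ≡ 10 * (r * r)
        eq′ = solve-∀
      eq : ∀ l k′ r n m →
           1 + 2 * (l * (1 + k′ + 4 * r)) + (1 + k′ + (1 + k′ + (10 * (r * r) + 2 * (n + m)))) + 0
           ≡ 2 * m + (2 * n + (1 + 10 * (r * r) + (2 * (l * (4 * r + 1)) + 2 * ((1 + l) * k′ + 1))))
      eq = solve-∀

    seeds : Σ (Fin ℓ → A) λ w → (∀ i → w i ∈ U × cdeg U (w i) ≤ k + 4 * R) × Indep w
    seeds =
      let w , w∈ , indep = greedy-transversal ℓ (k + 4 * R) (λ _ → low)
            (λ i j _ x∈ → ≤-trans (∑-filterᵇ≤ _ U _) (low-deg x∈)) (λ _ → low-large)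
      in w , (λ i → proj₁ (∈-filterᵇ⁻ _ (w∈ i)) , low-deg (w∈ i)) , indep

    -- The closed neighbourhoods of the low-degree independent vertices w i cover U and have total size |U| + O(R²),
    -- so all but O(R²) vertices are covered exactly once.
    module Parts (w : Fin ℓ → A) (w-low : ∀ i → w i ∈ U × cdeg U (w i) ≤ k + 4 * R) (w-indep : Indep w) where

      w∈U : ∀ i → w i ∈ U
      w∈U i = proj₁ (w-low i)

      covers : A → ℕ
      covers y = ∑ (allFin ℓ) (λ i → ⟦ nb (w i) y ⟧)

      shared : A → Bool
      shared y = 2 ≤ᵇ covers y

      private-nbᵇ : Fin ℓ → A → Bool
      private-nbᵇ i y = nb (w i) y ∧ not (shared y)

      P : Fin ℓ → List A
      P i = filterᵇ (private-nbᵇ i) U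

      -- A vertex outside all these closed neighbourhoods would extend `w` to `suc ℓ` independent
      -- vertices.
      covered : ∀ {y} → y ∈ U → 1 ≤ covers y
      covered {y} y∈ with covers y in eq
      ... | suc _ = s≤s z≤n
      ... | zero  = contradiction (hasIndep-∷ y∈ w∈U (λ i → trans (nb-sym y (w i)) (off i)) w-indep) noIndep
        where
        off : ∀ i → nb (w i) y ≡ false
        off i with nb (w i) y in e
        ... | false = refl
        ... | true  = contradiction (≤-trans (≤-trans (≤-reflexive (sym (cong ⟦_⟧ e))) (∈⇒≤∑ (λ i → ⟦ nb (w i) y ⟧) (∈-allFin i))) (≤-reflexive eq)) λ ()

      few-shared : ∑ U (⟦_⟧ ∘ shared) ≤ Λ
      few-shared = begin
        S                      ≤⟨ ≤-cert 1 total (eq ℓ k′ R S) ⟩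
        ℓ * (4 * R + 1)    ≤⟨ *-mono-≤ ℓ≤R 4R+1≤5R ⟩
        R * (5 * R)            ∎
        where
        S = ∑ U (⟦_⟧ ∘ shared)
        eq : ∀ l k′ r s → s + l * (1 + k′ + 4 * r) + 1 ≡ l * (4 * r + 1) + (s + (l * k′ + 1))
        eq = solve-∀
        pointwise : ∀ {y} → y ∈ U → ⟦ shared y ⟧ + 1 ≤ covers y
        pointwise {y} y∈ with shared y in e
        ... | true  = ≤ᵇ-true⁻¹ e
        ... | false = covered y∈
        total : S + (ℓ * k′ + 1) ≤ ℓ * (k + 4 * R)
        total = begin
          S + (ℓ * k′ + 1)                             ≡⟨ cong (S +_) (trans (sym size) (sym (∑-1 U))) ⟩
          S + ∑ U (λ _ → 1)                                ≡⟨ ∑-+ U _ _ ⟨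
          ∑ U (λ y → ⟦ shared y ⟧ + 1)                     ≤⟨ ∑-mono U pointwise ⟩
          ∑ U covers                                       ≡⟨ ∑-swap U (allFin ℓ) (λ y i → ⟦ nb (w i) y ⟧) ⟩
          ∑ (allFin ℓ) (λ i → cdeg U (w i))          ≤⟨ ∑-mono (allFin ℓ) (λ {i} _ → proj₂ (w-low i)) ⟩
          ∑ (allFin ℓ) (λ _ → k + 4 * R)             ≡⟨ ∑-const (allFin ℓ) _ ⟩
          length (allFin ℓ) * (k + 4 * R)            ≡⟨ cong (_* (k + 4 * R)) (length-tabulate {n = ℓ} (λ i → i)) ⟩
          ℓ * (k + 4 * R)                              ∎

      nb-twice : ∀ {i j y} → i ≢ j → nb (w i) y ≡ true → nb (w j) y ≡ true → shared y ≡ true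
      nb-twice {i} {j} {y} i≢j iy jy = ≤ᵇ-true (begin
        2                                                                       ≤⟨ +-mono-≤ (∑-point≥1 Fin._≟_ (∈-allFin i)) (∑-point≥1 Fin._≟_ (∈-allFin j)) ⟩
        ∑ (allFin ℓ) (at i) + ∑ (allFin ℓ) (at j)                   ≡⟨ ∑-+ (allFin ℓ) (at i) (at j) ⟨
        ∑ (allFin ℓ) (λ m → at i m + at j m)                              ≤⟨ ∑-mono (allFin ℓ) (λ {m} _ → pointwise m) ⟩
        covers y                                                                ∎)
        where
        at : Fin ℓ → Fin ℓ → ℕ
        at i m = ⟦ does (i Fin.≟ m) ⟧
        pointwise : ∀ m → at i m + at j m ≤ ⟦ nb (w m) y ⟧
        pointwise m with i Fin.≟ m | j Fin.≟ m
        ... | yes refl | yes refl = contradiction refl i≢j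
        ... | yes refl | no _     = ≤-reflexive (sym (cong ⟦_⟧ iy))
        ... | no _     | yes refl = ≤-reflexive (sym (cong ⟦_⟧ jy))
        ... | no _     | no _     = z≤n

      private-other : ∀ {i j y} → i ≢ j → private-nbᵇ i y ≡ true → nb (w j) y ≡ false
      private-other {i} {j} {y} i≢j py with nb (w j) y in e
      ... | false = refl
      ... | true  = contradiction (trans (sym (not-true (proj₂ (∧-true py)))) (nb-twice i≢j (proj₁ (∧-true py)) e)) false≢true

      -- Two non-adjacent private neighbours of w i could replace w i in the independent set w.
      clique : ∀ i {x y} → x ∈ P i → y ∈ P i → nb x y ≡ true
      clique i {x} {y} x∈ y∈ with nb x y in e
      ... | true  = refl
      ... | false = contradiction (hasIndep-∷ x∈U z∈U x-z (indep-updateAt (λ j j≢i → trans (nb-sym y (w j)) (private-other (j≢i ∘ sym) py)) w-indep)) noIndep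
        where
        x∈U = proj₁ (∈-filterᵇ⁻ (private-nbᵇ i) x∈)
        y∈U = proj₁ (∈-filterᵇ⁻ (private-nbᵇ i) y∈)
        px  = proj₂ (∈-filterᵇ⁻ (private-nbᵇ i) {xs = U} x∈)
        py  = proj₂ (∈-filterᵇ⁻ (private-nbᵇ i) {xs = U} y∈)
        z = updateAt w i (λ _ → y)
        z∈U : ∀ j → z j ∈ U
        z∈U j with j Fin.≟ i
        ... | yes refl = subst (_∈ U) (sym (updateAt-updates i w)) y∈U
        ... | no j≢i   = subst (_∈ U) (sym (updateAt-minimal j i w j≢i)) (w∈U j)
        x-z : ∀ j → nb x (z j) ≡ false
        x-z j with j Fin.≟ i
        ... | yes refl = trans (cong (nb x) (updateAt-updates i w)) e
        ... | no j≢i   = trans (cong (nb x) (updateAt-minimal j i w j≢i)) (trans (nb-sym x (w j)) (private-other (j≢i ∘ sym) px))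

      cdeg-clique : ∀ i {x} → x ∈ P i → cdeg (P i) x ≡ length (P i)
      cdeg-clique i x∈ = trans (∑-cong (P i) (λ y∈ → cong ⟦_⟧ (clique i x∈ y∈))) (∑-1 (P i))

      P-large : ∀ i → k ≤ length (P i) + Λ
      P-large i = begin
        k                                                        ≤⟨ minDeg (w∈U i) ⟩
        cdeg U (w i)                                             ≤⟨ ∑-mono U (λ {y} _ → pointwise (nb (w i) y) (shared y)) ⟩
        ∑ U (λ y → ⟦ private-nbᵇ i y ⟧ + ⟦ shared y ⟧)           ≡⟨ ∑-+ U _ _ ⟩
        ∑ U (⟦_⟧ ∘ private-nbᵇ i) + ∑ U (⟦_⟧ ∘ shared)           ≡⟨ cong (_+ _) (length-filterᵇ (private-nbᵇ i) U) ⟨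
        length (P i) + ∑ U (⟦_⟧ ∘ shared)                        ≤⟨ +-monoʳ-≤ _ few-shared ⟩
        length (P i) + Λ                                         ∎
        where
        pointwise : ∀ a b → ⟦ a ⟧ ≤ ⟦ a ∧ not b ⟧ + ⟦ b ⟧
        pointwise true  true  = ≤-refl
        pointwise true  false = ≤-refl
        pointwise false b     = z≤n

      -- `P i` and `P j` are disjoint, as a private neighbour has only one seed. Hence a vertex of
      -- `P i`, joined to its whole clique, has only the excess of its degree over `length (P i)`
      -- left for `P j`.
      two-cliques : ∀ {i j} x → i ≢ j → cdeg (P i) x + cdeg (P j) x ≤ cdeg U x
      two-cliques {i} {j} x i≢j = begin
        cdeg (P i) x + cdeg (P j) x
          ≡⟨ cong₂ _+_ (∑-filterᵇ (private-nbᵇ i) U _) (∑-filterᵇ (private-nbᵇ j) U _) ⟩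
        ∑ U (λ y → ⟦ private-nbᵇ i y ⟧ * ⟦ nb x y ⟧) + ∑ U (λ y → ⟦ private-nbᵇ j y ⟧ * ⟦ nb x y ⟧)
          ≡⟨ ∑-+ U _ _ ⟨
        ∑ U (λ y → ⟦ private-nbᵇ i y ⟧ * ⟦ nb x y ⟧ + ⟦ private-nbᵇ j y ⟧ * ⟦ nb x y ⟧)
          ≤⟨ ∑-mono U (λ {y} _ → pointwise y) ⟩
        cdeg U x ∎
        where
        pointwise : ∀ y → ⟦ private-nbᵇ i y ⟧ * ⟦ nb x y ⟧ + ⟦ private-nbᵇ j y ⟧ * ⟦ nb x y ⟧ ≤ ⟦ nb x y ⟧
        pointwise y with private-nbᵇ i y in ei | private-nbᵇ j y in ej
        ... | true  | true  = contradiction (trans (sym (private-other i≢j ei)) (proj₁ (∧-true ej))) false≢true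
        ... | true  | false = ≤-reflexive (trans (+-identityʳ _) (*-identityˡ _))
        ... | false | true  = ≤-reflexive (*-identityˡ _)
        ... | false | false = z≤n

      miss : Fin ℓ → A → ℕ
      miss i y = length (nonNeighbours y (P i))

      -- Otherwise y together with a transversal of its non-neighbours in the cliques would be independent; the transversal exists
      -- because a vertex of degree at most k + h has few neighbours outside its own clique.
      nearly-joined : ∀ {y} → y ∈ U → ∃ λ i → miss i y ≤ q
      nearly-joined {y} y∈ with any? (λ i → miss i y ≤? q)
      ... | yes found = found
      ... | no  none  = contradiction
          (hasIndep-∷ y∈ (λ i → proj₁ (∈-filterᵇ⁻ (private-nbᵇ i) (Q⊆P i (z∈ i))))
                      (λ i → not-true (proj₂ (∈-filterᵇ⁻ (not ∘ nb y) {xs = P i} (proj₁ (∈-filterᵇ⁻ _ (z∈ i)))))) indep) noIndep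
        where
        -- Candidates for the transversal: non-neighbours of `y` of closed degree at most k + h.
        Q : Fin ℓ → List A
        Q i = filterᵇ (not ∘ high (suc h)) (nonNeighbours y (P i))
        Q⊆P : ∀ i {x} → x ∈ Q i → x ∈ P i
        Q⊆P i x∈ = proj₁ (∈-filterᵇ⁻ _ (proj₁ (∈-filterᵇ⁻ _ x∈)))
        few : ∀ i j → i ≢ j → ∀ {x} → x ∈ Q i → cdeg (Q j) x ≤ suc h + Λ
        few i j i≢j {x} x∈ = begin
          cdeg (Q j) x               ≤⟨ ∑-filterᵇ≤ _ (nonNeighbours y (P j)) _ ⟩
          cdeg (nonNeighbours y (P j)) x   ≤⟨ ∑-filterᵇ≤ _ (P j) _ ⟩
          cdeg (P j) x               ≤⟨ ≤-cert 0 (+-mono-≤ (two-cliques x i≢j) (+-mono-≤ deg≤ (+-mono-≤ (P-large i) (≤-reflexive (sym (cdeg-clique i (Q⊆P i x∈)))))))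
                                                 (eq (cdeg (P j) x) (cdeg U x) k (suc h) (length (P i)) Λ (cdeg (P i) x)) ⟩
          suc h + Λ                  ∎
          where
          deg≤ : cdeg U x ≤ k + suc h
          deg≤ = <⇒≤ (≤ᵇ-false⁻¹ (not-true (proj₂ (∈-filterᵇ⁻ (not ∘ high (suc h)) {xs = nonNeighbours y (P i)} x∈))))
          eq : ∀ d u k h p m d′ → d + (u + (k + h + (p + m + d′))) + 0 ≡ h + m + (d′ + d + (u + (k + p)))
          eq = solve-∀
        -- The two summands of `missing` are spent here: 2R(h + 1) on the discarded high-degree
        -- vertices, R(h + 1 + Λ) on the greedy choice.
        large : ∀ i → pred ℓ * (suc h + Λ) < length (Q i)
        large i = begin-strict
          pred ℓ * (suc h + Λ)     ≤⟨ *-monoˡ-≤ (suc h + Λ) (≤-trans pred[n]≤n ℓ≤R) ⟩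
          R * (suc h + Λ)     <⟨ +-cancelˡ-< (2 * R * suc h) _ _ (<-≤-trans (≰⇒> (λ le → none (i , le))) remaining) ⟩
          length (Q i)        ∎
          where
          remaining : miss i y ≤ 2 * R * suc h + length (Q i)
          remaining = begin
            miss i y                                                             ≡⟨ length-filterᵇ-not (high (suc h)) (nonNeighbours y (P i)) ⟩
            ∑ (nonNeighbours y (P i)) (⟦_⟧ ∘ high (suc h)) + length (Q i)              ≤⟨ +-monoˡ-≤ _ (∑-filterᵇ≤ _ (P i) _) ⟩
            ∑ (P i) (⟦_⟧ ∘ high (suc h)) + length (Q i)                          ≤⟨ +-monoˡ-≤ _ (∑-filterᵇ≤ _ U _) ⟩
            ∑ U (⟦_⟧ ∘ high (suc h)) + length (Q i)                              ≤⟨ +-monoˡ-≤ _ few-high₂ ⟩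
            2 * R * suc h + length (Q i)                                         ∎
        transversal = greedy-transversal (ℓ) (suc h + Λ) Q few large
        z∈    = proj₁ (proj₂ transversal)
        indep = proj₂ (proj₂ transversal)

      -- A shared vertex enters every clique to which it is nearly joined, so the parts may overlap;
      -- the pigeonhole in `W-large` rests on their covering `U`.
      joinedᵇ : Fin ℓ → A → Bool
      joinedᵇ i y = private-nbᵇ i y ∨ (shared y ∧ (miss i y ≤ᵇ q))

      W : Fin ℓ → List A
      W i = filterᵇ (joinedᵇ i) U

      joined : ∀ {y} → y ∈ U → ∃ λ i → joinedᵇ i y ≡ true
      joined {y} y∈ with shared y in e
      ... | true  = let i , le = nearly-joined y∈ in
                    i , trans (cong₂ _∨_ (∧-zeroʳ (nb (w i) y)) (≤ᵇ-true le)) refl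
      ... | false = let i , _ , 0<nb = ∑-pigeonhole (allFin ℓ) (λ i → ⟦ nb (w i) y ⟧) 0
                                         (≤-trans (≤-reflexive (cong suc (*-zeroʳ (length (allFin ℓ))))) (covered y∈))
                    in i , cong (λ b → b ∧ true ∨ false) (0<⟦⟧ 0<nb)
        where
        0<⟦⟧ : ∀ {b} → 0 < ⟦ b ⟧ → b ≡ true
        0<⟦⟧ {true} _ = refl

      W-large : ∃ λ i → k ≤ length (W i)
      W-large = let i , _ , lt = ∑-pigeonhole (allFin ℓ) (length ∘ W) k′ total in i , lt
        where
        total : length (allFin ℓ) * k′ < ∑ (allFin ℓ) (length ∘ W)
        total = begin-strict
          length (allFin ℓ) * k′                          ≡⟨ cong (_* k′) (length-tabulate {n = ℓ} (λ i → i)) ⟩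
          ℓ * k′                                            <⟨ ≤-reflexive (trans (+-comm 1 _) (sym size)) ⟩
          length U                                              ≡⟨ ∑-1 U ⟨
          ∑ U (λ _ → 1)                                         ≤⟨ ∑-mono U (λ {y} y∈ → let i , e = joined y∈ in
                                                                     ≤-trans (≤-reflexive (sym (cong ⟦_⟧ e))) (∈⇒≤∑ (λ i → ⟦ joinedᵇ i y ⟧) (∈-allFin i))) ⟩
          ∑ U (λ y → ∑ (allFin ℓ) (λ i → ⟦ joinedᵇ i y ⟧)) ≡⟨ ∑-swap U (allFin ℓ) (λ y i → ⟦ joinedᵇ i y ⟧) ⟩
          ∑ (allFin ℓ) (λ i → ∑ U (⟦_⟧ ∘ joinedᵇ i))      ≡⟨ ∑-cong (allFin ℓ) (λ {i} _ → sym (length-filterᵇ (joinedᵇ i) U)) ⟩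
          ∑ (allFin ℓ) (length ∘ W)                       ∎

      non : A → A → ℕ
      non x y = ⟦ not (nb x y) ⟧

      -- Private vertices form a clique, so a non-adjacent pair contains a shared vertex. At most
      -- `Λ` shared vertices miss at most `q` private ones each, counted in both orders, and pairs
      -- of shared vertices add at most `Λ * Λ`.
      ∑∑non-W : ∀ i → ∑ (W i) (λ x → ∑ (W i) (non x)) ≤ defect R h
      ∑∑non-W i = begin
        ∑ (W i) (λ x → ∑ (W i) (non x))
          ≤⟨ ∑-mono (W i) (λ {x} x∈ → ≤-trans (∑-mono (W i) (λ {y} y∈ → pointwise x y x∈ y∈))
               (≤-reflexive (trans (∑-+ (W i) _ _) (cong (∑ (W i) (towards x) +_) (∑-+ (W i) _ _))))) ⟩
        ∑ (W i) (λ x → ∑ (W i) (towards x) + (∑ (W i) (λ y → towards y x) + ∑ (W i) (λ y → sh x * sh y)))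
          ≡⟨ trans (∑-+ (W i) _ _) (cong (mixed +_) (∑-+ (W i) _ _)) ⟩
        mixed + (∑ (W i) (λ x → ∑ (W i) (λ y → towards y x)) + ∑ (W i) (λ x → ∑ (W i) (λ y → sh x * sh y)))
          ≡⟨ cong (mixed +_) (cong₂ _+_ (∑-swap (W i) (W i) (λ x y → towards y x)) inner) ⟩
        mixed + (mixed + S * S)
          ≤⟨ +-mono-≤ mixed≤ (+-mono-≤ mixed≤ (*-mono-≤ S≤Λ S≤Λ)) ⟩
        Λ * q + (Λ * q + Λ * Λ)
          ≡⟨ eq (Λ * q) (Λ * Λ) ⟩
        defect R h ∎
        where
        eq : ∀ a b → a + (a + b) ≡ 2 * a + b
        eq = solve-∀
        sh : A → ℕ
        sh x = ⟦ shared x ⟧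
        towards : A → A → ℕ
        towards x y = sh x * (⟦ private-nbᵇ i y ⟧ * non x y)
        mixed = ∑ (W i) (λ x → ∑ (W i) (towards x))
        S = ∑ (W i) sh
        S≤Λ : S ≤ Λ
        S≤Λ = ≤-trans (∑-filterᵇ≤ (joinedᵇ i) U sh) few-shared
        inner : ∑ (W i) (λ x → ∑ (W i) (λ y → sh x * sh y)) ≡ S * S
        inner = trans (∑-cong (W i) (λ {x} _ → trans (∑-* (W i) (sh x) sh) (*-comm (sh x) S))) (∑-* (W i) S sh)
        kind : ∀ {x} → x ∈ W i → private-nbᵇ i x ≡ true ⊎ shared x ≡ true × miss i x ≤ q
        kind {x} x∈ with private-nbᵇ i x | ∈-filterᵇ⁻ (joinedᵇ i) {xs = U} x∈
        ... | true  | _      = inj₁ refl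
        ... | false | _ , jx = inj₂ (proj₁ (∧-true jx) , ≤ᵇ-true⁻¹ (proj₂ (∧-true jx)))
        inU : ∀ {x} → x ∈ W i → x ∈ U
        inU x∈ = proj₁ (∈-filterᵇ⁻ (joinedᵇ i) x∈)
        pointwise : ∀ x y → x ∈ W i → y ∈ W i → non x y ≤ towards x y + (towards y x + sh x * sh y)
        pointwise x y x∈ y∈ with kind x∈ | kind y∈
        ... | inj₁ px | inj₁ py
            rewrite clique i (∈-filterᵇ⁺ (private-nbᵇ i) (inU x∈) px) (∈-filterᵇ⁺ (private-nbᵇ i) (inU y∈) py) = z≤n
        ... | inj₁ px | inj₂ (sy , _) = begin
            non x y                                      ≡⟨ cong (⟦_⟧ ∘ not) (nb-sym x y) ⟩
            non y x                                      ≡⟨ trans (*-identityˡ _) (*-identityˡ _) ⟨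
            1 * (1 * non y x)                            ≡⟨ cong₂ (λ a b → ⟦ a ⟧ * (⟦ b ⟧ * non y x)) sy px ⟨
            towards y x                                  ≤⟨ m≤m+n _ _ ⟩
            towards y x + sh x * sh y                    ≤⟨ m≤n+m _ (towards x y) ⟩
            towards x y + (towards y x + sh x * sh y)    ∎
        ... | inj₂ (sx , _) | inj₁ py = begin
            non x y                                      ≡⟨ trans (*-identityˡ _) (*-identityˡ _) ⟨
            1 * (1 * non x y)                            ≡⟨ cong₂ (λ a b → ⟦ a ⟧ * (⟦ b ⟧ * non x y)) sx py ⟨
            towards x y                                  ≤⟨ m≤m+n _ _ ⟩
            towards x y + (towards y x + sh x * sh y)    ∎
        ... | inj₂ (sx , _) | inj₂ (sy , _) = begin
            non x y                                      ≤⟨ ⟦b⟧≤1 _ ⟩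
            1 * 1                                        ≡⟨ cong₂ (λ a b → ⟦ a ⟧ * ⟦ b ⟧) sx sy ⟨
            sh x * sh y                                  ≤⟨ m≤n+m _ (towards y x) ⟩
            towards y x + sh x * sh y                    ≤⟨ m≤n+m _ (towards x y) ⟩
            towards x y + (towards y x + sh x * sh y)    ∎
        row : ∀ {x} → x ∈ W i → ∑ (W i) (towards x) ≤ sh x * q
        row {x} x∈ = begin
          ∑ (W i) (towards x)                                           ≡⟨ ∑-* (W i) (sh x) _ ⟩
          sh x * ∑ (W i) (λ y → ⟦ private-nbᵇ i y ⟧ * non x y)          ≤⟨ *-monoʳ-≤ (sh x) (∑-filterᵇ≤ (joinedᵇ i) U _) ⟩
          sh x * ∑ U (λ y → ⟦ private-nbᵇ i y ⟧ * non x y)              ≡⟨ cong (sh x *_) (trans (sym (∑-filterᵇ (private-nbᵇ i) U (non x))) (sym (length-filterᵇ (not ∘ nb x) (P i)))) ⟩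
          sh x * miss i x                                               ≤⟨ sh-miss ⟩
          sh x * q                                                      ∎
          where
          sh-miss : sh x * miss i x ≤ sh x * q
          sh-miss with kind x∈
          ... | inj₂ (_ , le) = *-monoʳ-≤ (sh x) le
          ... | inj₁ px rewrite not-true (proj₂ (∧-true {nb (w i) x} px)) = z≤n
        mixed≤ : mixed ≤ Λ * q
        mixed≤ = begin
          mixed                       ≤⟨ ∑-mono (W i) row ⟩
          ∑ (W i) (λ x → sh x * q)    ≡⟨ trans (∑-cong (W i) (λ {x} _ → *-comm (sh x) q)) (∑-* (W i) q sh) ⟩
          q * S                       ≤⟨ *-monoʳ-≤ q S≤Λ ⟩
          q * Λ                       ≡⟨ *-comm q Λ ⟩
          Λ * q                       ∎

      -- Passing to a sublist creates no new non-adjacent pairs, so a large part can be cut down to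
      -- exactly k vertices, the size at which a clique has 2(e - 1)/(w - 2) = k + 1.
      near-clique : Unique U → ∃ λ V → Unique V × length V ≡ k × k * k ≤ cdegSum V + defect R h
      near-clique uniq = V , Uniqueₚ.take⁺ k (Uniqueₚ.filter⁺ _ uniq) , |V|≡k , (begin
        k * k                                                  ≡⟨ cong₂ _*_ |V|≡k |V|≡k ⟨
        length V * length V                                    ≡⟨ ∑-const V (length V) ⟨
        ∑ V (λ _ → length V)                                   ≡⟨ ∑-cong V (λ {x} _ → trans (length-filterᵇ-not (nb x) V) (cong (cdeg V x +_) (length-filterᵇ (not ∘ nb x) V))) ⟩
        ∑ V (λ x → cdeg V x + ∑ V (non x))                     ≡⟨ ∑-+ V _ _ ⟩
        cdegSum V + ∑ V (λ x → ∑ V (non x))                    ≤⟨ +-monoʳ-≤ (cdegSum V) (≤-trans (∑-mono V (λ {x} _ → ∑-take k (W i) (non x))) (∑-take k (W i) _)) ⟩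
        cdegSum V + ∑ (W i) (λ x → ∑ (W i) (non x))            ≤⟨ +-monoʳ-≤ (cdegSum V) (∑∑non-W i) ⟩
        cdegSum V + defect R h                                 ∎)
        where
        i = proj₁ W-large
        V = take k (W i)
        |V|≡k = length-take-≤ k (W i) (proj₂ W-large)

  -- `u-large` says that `defect R h` is at most t(k - 2) with t = u/v: precisely the number of
  -- ordered non-adjacent pairs that k vertices can afford.
  module DenseSubset (R k′ h τ u v : ℕ)
    (0<R : 0 < R) (0<v : 0 < v)
    (τ+u : τ + u ≡ (suc k′ + 1) * v)
    (k-large : 10 * (R * R) < suc k′)
    (k≤h² : suc k′ ≤ suc h * suc h)
    (u-large : v * defect R h + 2 * u ≤ u * suc k′)
    where

    -- With e edges, w vertices and cdegSum W = 2e + w, this says 2v(e − 1) ≥ τ(w − 2), free of subtractions.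
    Dense : List A → Set
    Dense W = τ * length W + 2 * v + v * length W ≤ v * cdegSum W + 2 * τ

    -- Failure of density bounds the sum of closed degrees by (k + 1)(w - 2) + 2 + w = (k + 2)w -
    -- 2k.
    sparse⇒avgDeg : ∀ U → 2 ≤ length U → ¬ Dense U → cdegSum U ≤ (suc k′ + 2) * length U
    sparse⇒avgDeg U 2≤ sparse with length U
    ... | suc zero = contradiction 2≤ λ { (s≤s ()) }
    ... | suc (suc j) = *-cancelˡ-≤ v ⦃ >-nonZero 0<v ⦄ (≤-cert (2 * v * suc k′ + 1)
        (+-mono-≤ (≰⇒> sparse)
                  (*-monoˡ-≤ j (≤-trans (m≤m+n τ u) (≤-reflexive τ+u))))
        (eq v (cdegSum U) τ j k′))
      where
      eq : ∀ v s τ j k → v * s + (τ * (2 + j) + 2 * v + v * (2 + j) + (1 + k + 1) * v * j) + (2 * v * (1 + k) + 1)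
                       ≡ v * ((1 + k + 2) * (2 + j)) + (1 + (v * s + 2 * τ) + τ * j)
      eq = solve-∀

    -- By k(k - 1) - 2 = (k + 1)(k - 2), the value 2(e - 1) is at least (k + 1)(k - 2) -
    -- `defect R h`, and `u-large` pays for the defect.
    near-clique⇒dense : ∀ V → length V ≡ suc k′ → suc k′ * suc k′ ≤ cdegSum V + defect R h → Dense V
    near-clique⇒dense V e le rewrite e = ≤-cert 0
      (+-mono-≤ (*-monoʳ-≤ v le) (+-mono-≤ u-large
        (+-mono-≤ (*-monoˡ-≤ (suc k′) (≤-reflexive τ+u)) (*-monoʳ-≤ 2 (≤-reflexive (sym τ+u))))))
      (eq v (cdegSum V) τ u k′ (defect R h))
      where
      eq : ∀ v s τ u k d →
           τ * (1 + k) + 2 * v + v * (1 + k) + (v * (s + d) + (u * (1 + k) + ((1 + k + 1) * v * (1 + k) + 2 * (τ + u)))) + 0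
           ≡ v * s + 2 * τ + (v * ((1 + k) * (1 + k)) + (v * d + 2 * u + ((τ + u) * (1 + k) + 2 * ((1 + k + 1) * v))))
      eq = solve-∀

    3≤k : 3 ≤ suc k′
    3≤k = ≤-trans (≤-trans (s≤s (s≤s (s≤s z≤n))) (*-monoʳ-≤ 10 (*-mono-≤ 0<R 0<R))) (<⇒≤ k-large)

    -- Deleting a closed neighbourhood of at most `k′` vertices lowers `ℓ` by one, and `take`
    -- restores the exact size; at `ℓ = 0` the one remaining vertex contradicts `noIndep`. The size
    -- bounds on `W` place it among the boundedly many types of configuration that the random graph
    -- is made to avoid.
    dense-subset : ∀ ℓ → ℓ ≤ R → ∀ U → Unique U → length U ≡ ℓ * k′ + 1 → ¬ HasIndep (suc ℓ) U →
                   ∃ λ W → Unique W × 3 ≤ length W × length W ≤ length U × Dense W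
    dense-subset zero    _   (x ∷ []) uniq size noIndep =
      contradiction ((λ _ → x) , (λ _ → here refl) , λ { zero zero i≢j → contradiction refl i≢j }) noIndep
    dense-subset (suc ℓ) ℓ<R U uniq size noIndep with Any.any? (λ x → cdeg U x ≤? k′) U
    ... | yes found =
      let x , x∈ , d≤k′ = find found
          U₀ = nonNeighbours x U
          U′ = take (ℓ * k′ + 1) U₀
          enough : ℓ * k′ + 1 ≤ length U₀
          enough = ≤-cert 0 (+-mono-≤ d≤k′ (≤-reflexive (trans (sym size) (length-filterᵇ-not (nb x) U))))
                            (eq ℓ k′ (cdeg U x) (length U₀))
          |U′| = length-take-≤ (ℓ * k′ + 1) U₀ enough
          W , uW , 3≤ , |W|≤ , dense = dense-subset ℓ (<⇒≤ ℓ<R) U′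
            (Uniqueₚ.take⁺ (ℓ * k′ + 1) (Uniqueₚ.filter⁺ _ uniq)) |U′|
            (λ (z , z∈ , indep) → noIndep (hasIndep-∷ x∈
              (λ i → proj₁ (∈-filterᵇ⁻ _ (∈-take (ℓ * k′ + 1) (z∈ i))))
              (λ i → not-true (proj₂ (∈-filterᵇ⁻ (not ∘ nb x) {xs = U} (∈-take (ℓ * k′ + 1) (z∈ i))))) indep))
      in W , uW , 3≤ , ≤-trans |W|≤ (≤-trans (≤-reflexive |U′|) (≤-trans (+-monoˡ-≤ 1 (m≤n+m (ℓ * k′) k′)) (≤-reflexive (sym size)))) , dense
      where
      eq : ∀ l k d m → l * k + 1 + (k + (d + m)) + 0 ≡ m + (d + ((1 + l) * k + 1))
      eq = solve-∀
    ... | no none with τ * length U + 2 * v + v * length U ≤? v * cdegSum U + 2 * τ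
    ...   | yes dense  = U , uniq , ≤-trans 3≤k k≤|U| , ≤-refl , dense
      where
      k≤|U| : suc k′ ≤ length U
      k≤|U| = ≤-trans (≤-reflexive (+-comm 1 k′)) (≤-trans (+-monoˡ-≤ 1 (m≤m+n k′ (ℓ * k′))) (≤-reflexive (sym size)))
    ...   | no  sparse =
      let w , w-low , w-indep = seeds
          V , uV , |V| , large = Parts.near-clique w w-low w-indep uniq
      in V , uV , ≤-trans 3≤k (≤-reflexive (sym |V|)) , ≤-trans (≤-reflexive |V|) k≤|U| , near-clique⇒dense V |V| large
      where
      k≤|U| : suc k′ ≤ length U
      k≤|U| = ≤-trans (≤-reflexive (+-comm 1 k′)) (≤-trans (+-monoˡ-≤ 1 (m≤m+n k′ (ℓ * k′))) (≤-reflexive (sym size)))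
      open Structure R k′ (suc ℓ) h U size (s≤s z≤n) ℓ<R noIndep
             (λ x∈ → ≰⇒> (λ le → none (lose x∈ le)))
             (sparse⇒avgDeg U (≤-trans (s≤s (s≤s z≤n)) (≤-trans 3≤k k≤|U|)) sparse) k-large k≤h²

-- The alteration method

-- 𝔼 f is qᵉ times the expectation of f when the e coordinates are independent and each is true with probability 1/q, q = p + 1.
module Expectation (p : ℕ) where

  q : ℕ
  q = suc p

  opaque

    𝔼 : ∀ {e} → (Vec Bool e → ℕ) → ℕ
    𝔼 {zero}  f = f []
    𝔼 {suc e} f = 𝔼 (λ x → f (true ∷ x)) + p * 𝔼 (λ x → f (false ∷ x))

    𝔼-cong : ∀ {e} {f g : Vec Bool e → ℕ} → (∀ x → f x ≡ g x) → 𝔼 f ≡ 𝔼 g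
    𝔼-cong {zero}  f≡g = f≡g []
    𝔼-cong {suc e} f≡g = cong₂ _+_ (𝔼-cong (λ x → f≡g (true ∷ x))) (cong (p *_) (𝔼-cong (λ x → f≡g (false ∷ x))))

    𝔼-+ : ∀ {e} (f g : Vec Bool e → ℕ) → 𝔼 (λ x → f x + g x) ≡ 𝔼 f + 𝔼 g
    𝔼-+ {zero}  f g = refl
    𝔼-+ {suc e} f g = trans (cong₂ (λ a b → a + p * b) (𝔼-+ {e} (λ x → f (true ∷ x)) (λ x → g (true ∷ x))) (𝔼-+ {e} (λ x → f (false ∷ x)) (λ x → g (false ∷ x))))
      (eq p (𝔼 (λ x → f (true ∷ x))) (𝔼 (λ x → g (true ∷ x))) (𝔼 (λ x → f (false ∷ x))) (𝔼 (λ x → g (false ∷ x))))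
      where
      eq : ∀ p a b c d → a + b + p * (c + d) ≡ a + p * c + (b + p * d)
      eq = solve-∀

    𝔼-* : ∀ {e} c (f : Vec Bool e → ℕ) → 𝔼 (λ x → c * f x) ≡ c * 𝔼 f
    𝔼-* {zero}  c f = refl
    𝔼-* {suc e} c f = trans (cong₂ (λ a b → a + p * b) (𝔼-* {e} c (λ x → f (true ∷ x))) (𝔼-* {e} c (λ x → f (false ∷ x))))
      (eq p c (𝔼 (λ x → f (true ∷ x))) (𝔼 (λ x → f (false ∷ x))))
      where
      eq : ∀ p c a b → c * a + p * (c * b) ≡ c * (a + p * b)
      eq = solve-∀

    𝔼-0 : ∀ {e} → 𝔼 {e} (λ _ → 0) ≡ 0
    𝔼-0 {e} = 𝔼-* {e} 0 (λ _ → 0)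

    𝔼-∑ : ∀ {e} {A : Set} (xs : List A) (f : A → Vec Bool e → ℕ) → 𝔼 (λ x → ∑ xs (λ a → f a x)) ≡ ∑ xs (λ a → 𝔼 (f a))
    𝔼-∑ {e} []   f = 𝔼-0 {e}
    𝔼-∑ (a ∷ xs) f = trans (𝔼-+ (f a) _) (cong (𝔼 (f a) +_) (𝔼-∑ xs f))

    -- Fixing the first coordinate splits the mean into two branches of weights 1 and `p`; if the
    -- first is not below the threshold, the second must be.
    below-expectation : ∀ {e} (f : Vec Bool e → ℕ) a → 𝔼 f < q ^ e * a → ∃ λ x → f x < a
    below-expectation {zero}  f a lt = [] , subst (f [] <_) (*-identityˡ a) lt
    below-expectation {suc e} f a lt with 𝔼 (λ x → f (true ∷ x)) <? q ^ e * a
    ... | yes lt₁ = let x , fx<a = below-expectation _ a lt₁ in true ∷ x , fx<a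
    ... | no  ge₁ = let x , fx<a = below-expectation _ a lt₀ in false ∷ x , fx<a
      where
      lt₀ : 𝔼 (λ x → f (false ∷ x)) < q ^ e * a
      lt₀ = *-cancelˡ-< p _ _ (+-cancelˡ-< (q ^ e * a) _ _
        (≤-<-trans (+-monoˡ-≤ _ (≮⇒≥ ge₁)) (<-≤-trans lt (≤-reflexive (*-assoc q (q ^ e) a)))))

    -- Product rule: invariance under overwriting position `i` expresses that `f` is independent of
    -- that coordinate.
    𝔼-independent : ∀ {e} (i : Fin e) (g : Bool → ℕ) (f : Vec Bool e → ℕ) → (∀ x b → f (x [ i ]≔ b) ≡ f x) →
                    q * 𝔼 (λ x → g (lookup x i) * f x) ≡ (g true + p * g false) * 𝔼 f
    𝔼-independent {suc e} zero g f indep = begin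
      q * (𝔼 (λ x → g true * f (true ∷ x)) + p * 𝔼 (λ x → g false * f (false ∷ x)))
        ≡⟨ cong (q *_) (cong₂ (λ a b → a + p * b) (𝔼-* {e} (g true) (λ x → f (true ∷ x))) (𝔼-* {e} (g false) (λ x → f (false ∷ x)))) ⟩
      q * (g true * 𝔼 (λ x → f (true ∷ x)) + p * (g false * 𝔼 (λ x → f (false ∷ x))))
        ≡⟨ cong (λ a → q * (g true * a + p * (g false * F))) (𝔼-cong (λ x → indep (false ∷ x) true)) ⟩
      q * (g true * F + p * (g false * F))
        ≡⟨ eq p (g true) (g false) F ⟩
      (g true + p * g false) * (F + p * F)
        ≡⟨ cong (λ a → (g true + p * g false) * (a + p * F)) (𝔼-cong (λ x → indep (false ∷ x) true)) ⟨
      (g true + p * g false) * 𝔼 f ∎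
      where
      open ≡-Reasoning
      F : ℕ
      F = 𝔼 (λ x → f (false ∷ x))
      eq : ∀ p a b f → (1 + p) * (a * f + p * (b * f)) ≡ (a + p * b) * (f + p * f)
      eq = solve-∀
    𝔼-independent (suc i) g f indep =
      trans (trans (eq₁ q p _ _)
                   (cong₂ (λ a b → a + p * b)
                     (𝔼-independent i g (λ x → f (true ∷ x)) (λ x → indep (true ∷ x)))
                     (𝔼-independent i g (λ x → f (false ∷ x)) (λ x → indep (false ∷ x)))))
            (eq₂ p (g true + p * g false) (𝔼 (λ x → f (true ∷ x))) (𝔼 (λ x → f (false ∷ x))))
      where
      eq₁ : ∀ q p a b → q * (a + p * b) ≡ q * a + p * (q * b)
      eq₁ = solve-∀
      eq₂ : ∀ p c a b → c * a + p * (c * b) ≡ c * (a + p * b)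
      eq₂ = solve-∀

    𝔼-1 : ∀ e → 𝔼 {e} (λ _ → 1) ≡ q ^ e
    𝔼-1 zero    = refl
    𝔼-1 (suc e) = cong₂ (λ a b → a + p * b) (𝔼-1 e) (𝔼-1 e)

  ∏ : ∀ {e} → (Bool → ℕ) → List (Fin e) → Vec Bool e → ℕ
  ∏ g []       x = 1
  ∏ g (i ∷ is) x = g (lookup x i) * ∏ g is x

  ∏-update : ∀ {e} g {i : Fin e} is → All (i ≢_) is → ∀ x b → ∏ g is (x [ i ]≔ b) ≡ ∏ g is x
  ∏-update g []       _          x b = refl
  ∏-update g (j ∷ is) (i≢j ∷ i∉) x b = cong₂ (λ a c → g a * c) (lookup∘update′ (i≢j ∘ sym) x b) (∏-update g is i∉ x b)

  𝔼-∏ : ∀ {e} g {is : List (Fin e)} → Unique is → q ^ length is * 𝔼 (∏ g is) ≡ (g true + p * g false) ^ length is * q ^ e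
  𝔼-∏ {e} g [] = cong (1 *_) (𝔼-1 e)
  𝔼-∏ {e} g {i ∷ is} (i∉ ∷ u) = begin
    q * q ^ length is * 𝔼 (∏ g (i ∷ is))          ≡⟨ eq₁ q (q ^ length is) _ ⟩
    q ^ length is * (q * 𝔼 (∏ g (i ∷ is)))        ≡⟨ cong (q ^ length is *_) (𝔼-independent i g (∏ g is) (∏-update g is i∉)) ⟩
    q ^ length is * (c * 𝔼 (∏ g is))              ≡⟨ eq₂ (q ^ length is) c _ ⟩
    c * (q ^ length is * 𝔼 (∏ g is))              ≡⟨ cong (c *_) (𝔼-∏ g u) ⟩
    c * (c ^ length is * q ^ e)                   ≡⟨ *-assoc c (c ^ length is) (q ^ e) ⟨
    c * c ^ length is * q ^ e                     ∎
    where
    open ≡-Reasoning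
    c = g true + p * g false
    eq₁ : ∀ a b c → a * b * c ≡ b * (a * c)
    eq₁ = solve-∀
    eq₂ : ∀ a b c → a * (b * c) ≡ b * (a * c)
    eq₂ = solve-∀

  present : ∀ {e} → List (Fin e) → Vec Bool e → ℕ
  present = ∏ ⟦_⟧

  present-all : ∀ {e} {is : List (Fin e)} {x} → All (λ i → lookup x i ≡ true) is → present is x ≡ 1
  present-all []         = refl
  present-all (xi ∷ all) rewrite xi = trans (+-identityʳ _) (present-all all)

  -- Markov's inequality for soft bounds the probability that few of the given indices are true.
  soft : ∀ {e} → List (Fin e) → Vec Bool e → ℕ
  soft = ∏ (λ b → if b then 1 else 2)

  soft-≥ : ∀ {e} (is : List (Fin e)) x → 2 ^ length is ≡ 2 ^ length (filterᵇ (lookup x) is) * soft is x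
  soft-≥ []       x = refl
  soft-≥ (i ∷ is) x with lookup x i
  ... | true  = trans (cong (2 *_) (soft-≥ is x)) (eq (2 ^ length (filterᵇ (lookup x) is)) (soft is x))
    where
    eq : ∀ a b → 2 * (a * b) ≡ 2 * a * (1 * b)
    eq = solve-∀
  ... | false = trans (cong (2 *_) (soft-≥ is x)) (eq (2 ^ length (filterᵇ (lookup x) is)) (soft is x))
    where
    eq : ∀ a b → 2 * (a * b) ≡ a * (2 * b)
    eq = solve-∀

  module _ {e : ℕ} where

    open import Data.List.Relation.Unary.Unique.DecPropositional (Fin._≟_ {e}) using (unique?)

    -- Counts the J-element subfamilies of Bs that are disjoint, also from is, with all of their indices and those of is true.
    packings : ℕ → List (List (Fin e)) → List (Fin e) → Vec Bool e → ℕ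
    packings zero    Bs       is x = ⟦ does (unique? is) ⟧ * present is x
    packings (suc J) []       is x = 0
    packings (suc J) (B ∷ Bs) is x = packings (suc J) Bs is x + packings J Bs (B ++ is) x

    -- The sum μ of q^(-|B|) over the family, scaled by `q ^ M` to an integer.
    cost : ℕ → List (List (Fin e)) → ℕ
    cost M Bs = ∑ Bs (λ B → q ^ (M ∸ length B))

    -- Two terms of the binomial expansion. With `y` the cost of the head of a family and `s` that
    -- of its tail, they drive the induction behind μ^J / J!.
    binomial-≥ : ∀ J y s → s ^ suc J + suc J * (y * s ^ J) ≤ (y + s) ^ suc J
    binomial-≥ zero    y s = ≤-reflexive (eq y s)
      where
      eq : ∀ y s → s * 1 + 1 * (y * 1) ≡ (y + s) * 1
      eq = solve-∀
    binomial-≥ (suc J) y s = ≤-trans (≤-cert (suc J * (y * y * s ^ J)) ≤-refl (eq y s (s ^ J) J))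
                                     (*-monoʳ-≤ (y + s) (binomial-≥ J y s))
      where
      eq : ∀ y s t J → s * (s * t) + (2 + J) * (y * (s * t)) + 0 + (1 + J) * (y * y * t)
                     ≡ (y + s) * (s * t + (1 + J) * (y * t)) + 0
      eq = solve-∀

    -- Disjoint sets are present independently, so the mean is at most the elementary symmetric
    -- function of degree `J` in the q^(-|B|), hence at most μ^J / J!. The list `is` collects the
    -- indices already demanded, and a repetition in it gives weight 0.
    𝔼-packings : ∀ M J Bs is → All (λ B → length B ≤ M) Bs →
                 J ! * (𝔼 (packings J Bs is) * (q ^ length is * (q ^ M) ^ J)) ≤ q ^ e * cost M Bs ^ J
    𝔼-packings M zero Bs is _ with unique? is
    ... | yes u = ≤-reflexive (begin
        1 * (𝔼 (λ x → 1 * present is x) * (q ^ length is * 1))   ≡⟨ cong (λ a → 1 * (a * (q ^ length is * 1))) (𝔼-cong (λ x → *-identityˡ (present is x))) ⟩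
        1 * (𝔼 (present is) * (q ^ length is * 1))               ≡⟨ eq (𝔼 (present is)) (q ^ length is) ⟩
        q ^ length is * 𝔼 (present is)                           ≡⟨ 𝔼-∏ ⟦_⟧ u ⟩
        (1 + p * 0) ^ length is * q ^ e                          ≡⟨ cong (λ a → (1 + a) ^ length is * q ^ e) (*-zeroʳ p) ⟩
        1 ^ length is * q ^ e                                    ≡⟨ cong (_* q ^ e) (^-zeroˡ (length is)) ⟩
        1 * q ^ e                                                ≡⟨ *-comm 1 (q ^ e) ⟩
        q ^ e * 1                                                ∎)
      where
      open ≡-Reasoning
      eq : ∀ a b → 1 * (a * (b * 1)) ≡ b * a
      eq = solve-∀
    ... | no _  = ≤-trans (≤-reflexive (cong (λ a → 1 * (a * (q ^ length is * 1))) 𝔼-0)) z≤n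
    𝔼-packings M (suc J) [] is _ = ≤-trans (≤-reflexive (trans (cong (λ a → suc J ! * (a * (q ^ length is * (q ^ M) ^ suc J))) 𝔼-0) (*-zeroʳ (suc J !)))) z≤n
    𝔼-packings M (suc J) (B ∷ Bs) is (B≤M ∷ Bs≤M) = begin
      suc J ! * (𝔼 (packings (suc J) (B ∷ Bs) is) * (a * (c * c ^ J)))
        ≡⟨ cong (λ z → suc J ! * (z * (a * (c * c ^ J)))) (𝔼-+ _ _) ⟩
      suc J * J ! * ((E₁ + E₂) * (a * (c * c ^ J)))
        ≡⟨ eq₁ (suc J) (J !) E₁ E₂ a c (c ^ J) ⟩
      suc J * J ! * (E₁ * (a * (c * c ^ J))) + suc J * (J ! * (E₂ * (c * a * c ^ J)))
        ≡⟨ cong (λ z → suc J * J ! * (E₁ * (a * (c * c ^ J))) + suc J * (J ! * (E₂ * (z * a * c ^ J)))) split ⟩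
      suc J * J ! * (E₁ * (a * (c * c ^ J))) + suc J * (J ! * (E₂ * (y * b * a * c ^ J)))
        ≡⟨ cong (λ z → suc J * J ! * (E₁ * (a * (c * c ^ J))) + z) (eq₂ (suc J) (J !) E₂ y b a (c ^ J)) ⟩
      suc J * J ! * (E₁ * (a * (c * c ^ J))) + suc J * (y * (J ! * (E₂ * (b * a * c ^ J))))
        ≡⟨ cong (λ z → suc J * J ! * (E₁ * (a * (c * c ^ J))) + suc J * (y * (J ! * (E₂ * (z * c ^ J))))) joint ⟩
      suc J * J ! * (E₁ * (a * (c * c ^ J))) + suc J * (y * (J ! * (E₂ * (q ^ length (B ++ is) * c ^ J))))
        ≤⟨ +-mono-≤ (𝔼-packings M (suc J) Bs is Bs≤M) (*-monoʳ-≤ (suc J) (*-monoʳ-≤ y (𝔼-packings M J Bs (B ++ is) Bs≤M))) ⟩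
      q ^ e * s ^ suc J + suc J * (y * (q ^ e * s ^ J))
        ≡⟨ eq₃ (q ^ e) (s ^ suc J) (suc J) y (s ^ J) ⟩
      q ^ e * (s ^ suc J + suc J * (y * s ^ J))
        ≤⟨ *-monoʳ-≤ (q ^ e) (binomial-≥ J y s) ⟩
      q ^ e * (y + s) ^ suc J ∎
      where
      open ≤-Reasoning
      E₁ = 𝔼 (packings (suc J) Bs is)
      E₂ = 𝔼 (packings J Bs (B ++ is))
      a = q ^ length is
      b = q ^ length B
      c = q ^ M
      y = q ^ (M ∸ length B)
      s = cost M Bs
      split : c ≡ y * b
      split = trans (cong (q ^_) (sym (m∸n+n≡m B≤M))) (^-distribˡ-+-* q (M ∸ length B) (length B))
      joint : b * a ≡ q ^ length (B ++ is)
      joint = trans (sym (^-distribˡ-+-* q (length B) (length is))) (cong (q ^_) (sym (length-++ B)))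
      eq₁ : ∀ n f E F a c d → n * f * ((E + F) * (a * (c * d))) ≡ n * f * (E * (a * (c * d))) + n * (f * (F * (c * a * d)))
      eq₁ = solve-∀
      eq₂ : ∀ n f F y b a d → n * (f * (F * (y * b * a * d))) ≡ n * (y * (f * (F * (b * a * d))))
      eq₂ = solve-∀
      eq₃ : ∀ Q t n y s → Q * t + n * (y * (Q * s)) ≡ Q * (t + n * (y * s))
      eq₃ = solve-∀

    -- The first `J` members of `F` occur in `Bs` in the same order and form one of the counted
    -- subfamilies.
    packings-≥1 : ∀ J {F Bs is x} → J ≤ length F → F ⊆ Bs → AllPairs Disjoint F →
                  All (λ B → Unique B × All (λ i → lookup x i ≡ true) B) F →
                  Unique is → All (λ i → lookup x i ≡ true) is → All (λ B → Disjoint B is) F →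
                  1 ≤ packings J Bs is x
    packings-≥1 zero {is = is} _ _ _ _ u on _ with unique? is
    ... | yes _ = ≤-reflexive (sym (trans (*-identityˡ _) (present-all on)))
    ... | no ¬u = contradiction u ¬u
    packings-≥1 (suc J) J≤ (B ∷ʳ sub) dis good u on off =
      ≤-trans (packings-≥1 (suc J) J≤ sub dis good u on off) (m≤m+n _ _)
    packings-≥1 (suc J) {B ∷ F} {_ ∷ Bs} {is} {x} (s≤s J≤) (refl ∷ sub) (B# ∷ dis) ((uB , onB) ∷ good) u on (B#is ∷ off) =
      ≤-trans (packings-≥1 J J≤ sub dis good (Uniqueₚ.++⁺ uB u B#is) (Allₚ.++⁺ onB on)
                 (disjoint-++ B# off))
              (m≤n+m _ (packings (suc J) Bs is x))
      where
      disjoint-++ : ∀ {F} → All (Disjoint B) F → All (λ C → Disjoint C is) F → All (λ C → Disjoint C (B ++ is)) F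
      disjoint-++ []          []           = []
      disjoint-++ (B#C ∷ B#) (C#is ∷ off) =
        (λ (∈C , ∈Bis) → [ (λ ∈B → B#C (∈B , ∈C)) , (λ ∈is → C#is (∈C , ∈is)) ] (∈-++⁻ B ∈Bis)) ∷ disjoint-++ B# off

    open DecMembership (Fin._≟_ {e}) using (_∈?_)

    On : Vec Bool e → List (Fin e) → Set
    On x B = Unique B × All (λ i → lookup x i ≡ true) B

    -- Greedy choice from the end of the list. The element of `B` supplies the common index when `B`
    -- was itself chosen.
    maximal-packing : ∀ x Bs → ∃ λ F → F ⊆ Bs × AllPairs Disjoint F × All (On x) F ×
                      (∀ {B} → B ∈ Bs → On x B → ∃ (_∈ B) → ∃ λ i → i ∈ B × i ∈ concat F)
    maximal-packing x []       = [] , [] , [] , [] , λ ()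
    maximal-packing x (B ∷ Bs) with maximal-packing x Bs
    ... | F , sub , dis , on , maximal with unique? B ×-dec All.all? (λ i → lookup x i Bool.≟ true) B | Any.any? (_∈? concat F) B
    ...   | no ¬onB | _       = F , B ∷ʳ sub , dis , on , λ
      { (here refl) onB _ → contradiction onB ¬onB ; (there B∈) → maximal B∈ }
    ...   | yes onB | yes met = F , B ∷ʳ sub , dis , on , λ
      { (here refl) _ _ → find met ; (there B∈) → maximal B∈ }
    ...   | yes onB | no ¬met = B ∷ F , refl ∷ sub , All.tabulate (λ C∈ (∈B , ∈C) → ¬met (lose ∈B (∈-concat⁺′ ∈C C∈))) ∷ dis , onB ∷ on , λ
      { (here refl) _ (i , i∈) → i , i∈ , ∈-++⁺ˡ i∈
      ; (there C∈) onC ne → let i , i∈C , i∈F = maximal C∈ onC ne in i , i∈C , ∈-++⁺ʳ B i∈F }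

    meets : List (Fin e) → List (Fin e) → Bool
    meets S B = does (Any.any? (_∈? S) B)

    meets⁺ : ∀ {S B i} → i ∈ B → i ∈ S → meets S B ≡ true
    meets⁺ {S} {B} i∈B i∈S with Any.any? (_∈? S) B
    ... | yes _ = refl
    ... | no ¬m = contradiction (lose i∈B i∈S) ¬m

    meets⁻ : ∀ S B → meets S B ≡ true → ∃ λ i → i ∈ B × i ∈ S
    meets⁻ S B eq with Any.any? (_∈? S) B
    ... | yes met = find met

    filterᵇ-⊆ : ∀ {A : Set} (f : A → Bool) {xs ys} → xs ⊆ ys → filterᵇ f xs ⊆ filterᵇ f ys
    filterᵇ-⊆ f []           = []
    filterᵇ-⊆ f (y ∷ʳ sub) with f y
    ... | true  = y ∷ʳ filterᵇ-⊆ f sub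
    ... | false = filterᵇ-⊆ f sub
    filterᵇ-⊆ f (_∷_ {x} refl sub) with f x
    ... | true  = refl ∷ filterᵇ-⊆ f sub
    ... | false = filterᵇ-⊆ f sub

    length-concat : ∀ {A : Set} M (xss : List (List A)) → All (λ xs → length xs ≤ M) xss → length (concat xss) ≤ length xss * M
    length-concat M []         []        = z≤n
    length-concat M (xs ∷ xss) (≤M ∷ ≤Ms) = ≤-trans (≤-reflexive (length-++ xs)) (+-mono-≤ ≤M (length-concat M xss ≤Ms))

    remaining : Vec Bool e → List (List (Fin e)) → Fin e → Bool
    remaining x F i = lookup x i ∧ not (does (i ∈? concat F))

    remaining-off : ∀ x F {i} → i ∈ concat F → remaining x F i ≡ false
    remaining-off x F {i} i∈ with lookup x i | i ∈? concat F
    ... | true  | yes _  = refl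
    ... | false | _      = refl
    ... | true  | no i∉ = contradiction i∈ i∉

    removed : ∀ x F {i} → lookup x i ≡ true → ¬ remaining x F i ≡ true → i ∈ concat F
    removed x F {i} xi yi with i ∈? concat F
    ... | yes i∈ = i∈
    ... | no  _  = contradiction (cong (_∧ true) xi) yi

    remaining-edge : ∀ {𝓑 M J x F S} → All (λ B → length B ≤ M) 𝓑 → F ⊆ 𝓑 → AllPairs Disjoint F → All (On x) F → Unique S →
      2 ^ length S * packings J (filterᵇ (meets S) 𝓑) [] x + 2 ^ (J * M) * soft S x < 2 ^ length S →
      ∃ λ i → i ∈ S × remaining x F i ≡ true
    remaining-edge {𝓑} {M} {J} {x} {F} {S} B≤M F⊆𝓑 F-disjoint F-on uS small with Any.any? (λ i → remaining x F i Bool.≟ true) S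
    ... | yes found = find found
    ... | no  none  = contradiction small (≤⇒≯ 2^N≤f)
      where
      open ≤-Reasoning
      F′ = filterᵇ (meets S) F
      few-true : length F′ ≤ J → length (filterᵇ (lookup x) S) ≤ J * M
      few-true le = begin
        length (filterᵇ (lookup x) S)   ≤⟨ length-⊆ Fin._≟_ (Uniqueₚ.filter⁺ _ uS) in-F′ ⟩
        length (concat F′)              ≤⟨ length-concat M F′ (Allₚ.filter⁺ _ (All-resp-⊆ F⊆𝓑 B≤M)) ⟩
        length F′ * M                   ≤⟨ *-monoˡ-≤ M le ⟩
        J * M                           ∎
        where
        in-F′ : ∀ {i} → i ∈ filterᵇ (lookup x) S → i ∈ concat F′
        in-F′ i∈ =
          let i∈S , xi = ∈-filterᵇ⁻ (lookup x) i∈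
              B , i∈B , B∈F = ∈-concat⁻′ F (removed x F xi (λ yi → none (lose i∈S yi)))
          in ∈-concat⁺′ i∈B (∈-filterᵇ⁺ (meets S) B∈F (meets⁺ i∈B i∈S))
      2^N≤f : 2 ^ length S ≤ 2 ^ length S * packings J (filterᵇ (meets S) 𝓑) [] x + 2 ^ (J * M) * soft S x
      2^N≤f with ≤-total (length F′) J
      ... | inj₁ le = begin
        2 ^ length S                                         ≡⟨ soft-≥ S x ⟩
        2 ^ length (filterᵇ (lookup x) S) * soft S x         ≤⟨ *-monoˡ-≤ (soft S x) (^-monoʳ-≤ 2 (few-true le)) ⟩
        2 ^ (J * M) * soft S x                               ≤⟨ m≤n+m _ _ ⟩
        _                                                    ∎
      ... | inj₂ ge = begin
        2 ^ length S                                                ≡⟨ *-identityʳ (2 ^ length S) ⟨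
        2 ^ length S * 1                                            ≤⟨ *-monoʳ-≤ (2 ^ length S) (packings-≥1 J ge (filterᵇ-⊆ (meets S) F⊆𝓑)
                                                                  (AllPairsₚ.filter⁺ _ F-disjoint) (Allₚ.filter⁺ _ F-on) [] [] (All.tabulate (λ _ → λ { (_ , ()) }))) ⟩
        2 ^ length S * packings J (filterᵇ (meets S) 𝓑) [] x        ≤⟨ m≤m+n _ _ ⟩
        _                                                    ∎

    Alteration : (𝓑 𝓢 : List (List (Fin e))) → Set
    Alteration 𝓑 𝓢 = ∃ λ (y : Fin e → Bool) →
      (∀ {B} → B ∈ 𝓑 → Unique B → ∃ (_∈ B) → ¬ All (λ i → y i ≡ true) B) ×
      (∀ {S} → S ∈ 𝓢 → ∃ λ i → i ∈ S × y i ≡ true)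

    -- Removing a maximal family of disjoint configurations destroys all of them. If S then lost all of its edges, it met J of the
    -- removed configurations or had at most J * M edges to begin with; the weights 2 ^ N and 2 ^ (J * M) make either event
    -- contribute at least 2 ^ N to the sum whose expectation is bounded.
    alteration : ∀ (𝓑 𝓢 : List (List (Fin e))) M J N K → 0 < K → length 𝓢 ≤ K →
      All (λ B → length B ≤ M) 𝓑 →
      (∀ {S} → S ∈ 𝓢 → Unique S × length S ≡ N) →
      (∀ {S} → S ∈ 𝓢 → 4 * (K * 𝔼 (packings J (filterᵇ (meets S) 𝓑) [])) ≤ q ^ e) →
      (∀ {S} → S ∈ 𝓢 → 4 * (K * (2 ^ (J * M) * 𝔼 (soft S))) ≤ q ^ e * 2 ^ N) →
      Alteration 𝓑 𝓢
    alteration 𝓑 𝓢 M J N K 0<K |𝓢|≤K B≤M shape few-packings few-sparse = conclude (below-expectation _ (2 ^ N) total)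
      where
      open ≤-Reasoning
      f : List (Fin e) → Vec Bool e → ℕ
      f S x = 2 ^ N * packings J (filterᵇ (meets S) 𝓑) [] x + 2 ^ (J * M) * soft S x
      Q = q ^ e * 2 ^ N
      0<Q : 0 < Q
      0<Q = *-mono-≤ (m^n>0 q e) (m^n>0 2 N)
      -- Each of the two terms takes at most Q/(4K), so `K` sets take at most Q/2.
      𝔼f : ∀ {S} → S ∈ 𝓢 → 4 * (K * 𝔼 (f S)) ≤ 2 * Q
      𝔼f {S} S∈ = begin
        4 * (K * 𝔼 (f S))                                 ≡⟨ cong (λ a → 4 * (K * a)) (trans (𝔼-+ _ _) (cong₂ _+_ (𝔼-* (2 ^ N) _) (𝔼-* (2 ^ (J * M)) _))) ⟩
        4 * (K * (2 ^ N * a + 2 ^ (J * M) * b))           ≡⟨ eq K (2 ^ N) a (2 ^ (J * M)) b ⟩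
        2 ^ N * (4 * (K * a)) + 4 * (K * (2 ^ (J * M) * b)) ≤⟨ +-mono-≤ (*-monoʳ-≤ (2 ^ N) (few-packings S∈)) (few-sparse S∈) ⟩
        2 ^ N * q ^ e + Q                                 ≡⟨ eq′ (2 ^ N) (q ^ e) ⟩
        2 * Q                                             ∎
        where
        a = 𝔼 (packings J (filterᵇ (meets S) 𝓑) [])
        b = 𝔼 (soft S)
        eq : ∀ k n a m b → 4 * (k * (n * a + m * b)) ≡ n * (4 * (k * a)) + 4 * (k * (m * b))
        eq = solve-∀
        eq′ : ∀ n q → n * q + q * n ≡ 2 * (q * n)
        eq′ = solve-∀
      total : 𝔼 (λ x → ∑ 𝓢 (λ S → f S x)) < Q
      total = *-cancelˡ-< 4 _ _ (≤-<-trans (*-cancelˡ-≤ K ⦃ >-nonZero 0<K ⦄ (begin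
        K * (4 * 𝔼 (λ x → ∑ 𝓢 (λ S → f S x)))     ≡⟨ cong (λ a → K * (4 * a)) (𝔼-∑ 𝓢 f) ⟩
        K * (4 * ∑ 𝓢 (λ S → 𝔼 (f S)))             ≡⟨ eq K _ ⟩
        4 * K * ∑ 𝓢 (λ S → 𝔼 (f S))               ≡⟨ ∑-* 𝓢 (4 * K) _ ⟨
        ∑ 𝓢 (λ S → 4 * K * 𝔼 (f S))               ≤⟨ ∑-mono 𝓢 (λ {S} S∈ → ≤-trans (≤-reflexive (*-assoc 4 K _)) (𝔼f S∈)) ⟩
        ∑ 𝓢 (λ _ → 2 * Q)                         ≡⟨ ∑-const 𝓢 (2 * Q) ⟩
        length 𝓢 * (2 * Q)                        ≤⟨ *-monoˡ-≤ (2 * Q) |𝓢|≤K ⟩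
        K * (2 * Q)                               ∎)) (*-monoˡ-< Q ⦃ >-nonZero 0<Q ⦄ {2} {4} (s≤s (s≤s (s≤s z≤n)))))
        where
        eq : ∀ k a → k * (4 * a) ≡ 4 * k * a
        eq = solve-∀
      conclude : (∃ λ x → ∑ 𝓢 (λ S → f S x) < 2 ^ N) → Alteration 𝓑 𝓢
      conclude (x , small) =
        let F , F⊆𝓑 , F-disjoint , F-on , F-maximal = maximal-packing x 𝓑 in
        remaining x F ,
        (λ B∈ uB ne all → let i , i∈B , i∈F = F-maximal B∈ (uB , All.map (λ {i} yi → proj₁ (∧-true {lookup x i} yi)) all) ne
                          in false≢true (trans (sym (remaining-off x F i∈F)) (All.lookup all i∈B))) ,
        (λ {S} S∈ → let uS , |S|≡N = shape S∈ in
                    remaining-edge {𝓑} {M} {J} {x} B≤M F⊆𝓑 F-disjoint F-on uS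
                      (subst (λ n → 2 ^ n * packings J (filterᵇ (meets S) 𝓑) [] x + 2 ^ (J * M) * soft S x < 2 ^ n) (sym |S|≡N)
                        (≤-<-trans (∈⇒≤∑ (λ S → f S x) S∈) small)))

-- Edge coordinates, vertex tuples and the configurations to be destroyed

tri : ℕ → ℕ
tri zero    = 0
tri (suc s) = s + tri s

tri-mono : ∀ {a b} → a ≤ b → tri a ≤ tri b
tri-mono z≤n       = z≤n
tri-mono (s≤s a≤b) = +-mono-≤ a≤b (tri-mono a≤b)

sublists : {A : Set} → List A → List (List A)
sublists []       = [] ∷ []
sublists (x ∷ xs) = sublists xs ++ map (x ∷_) (sublists xs)

module _ {A : Set} where

  length-sublists : ∀ (xs : List A) → length (sublists xs) ≡ 2 ^ length xs
  length-sublists []       = refl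
  length-sublists (x ∷ xs) = begin
    length (sublists xs ++ map (x ∷_) (sublists xs))             ≡⟨ length-++ (sublists xs) ⟩
    length (sublists xs) + length (map (x ∷_) (sublists xs))     ≡⟨ cong₂ _+_ (length-sublists xs) (trans (length-map (x ∷_) (sublists xs)) (length-sublists xs)) ⟩
    2 ^ length xs + 2 ^ length xs                                ≡⟨ cong (2 ^ length xs +_) (+-identityʳ _) ⟨
    2 * 2 ^ length xs                                            ∎
    where open ≡-Reasoning

  filterᵇ∈sublists : ∀ p (xs : List A) → filterᵇ p xs ∈ sublists xs
  filterᵇ∈sublists p []       = here refl
  filterᵇ∈sublists p (x ∷ xs) with p x
  ... | true  = ∈-++⁺ʳ (sublists xs) (∈-map⁺ (x ∷_) (filterᵇ∈sublists p xs))
  ... | false = ∈-++⁺ˡ (filterᵇ∈sublists p xs)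

  ∈-sublists-length : ∀ (xs : List A) {ys} → ys ∈ sublists xs → length ys ≤ length xs
  ∈-sublists-length []       (here refl) = z≤n
  ∈-sublists-length (x ∷ xs) ys∈ with ∈-++⁻ (sublists xs) ys∈
  ... | inj₁ ys∈′ = m≤n⇒m≤1+n (∈-sublists-length xs ys∈′)
  ... | inj₂ xys∈ with ∈-map⁻ (x ∷_) xys∈
  ...   | _ , ys∈′ , refl = s≤s (∈-sublists-length xs ys∈′)

  ∈-sublists-⊆ : ∀ (xs : List A) {ys y} → ys ∈ sublists xs → y ∈ ys → y ∈ xs
  ∈-sublists-⊆ []       (here refl) ()
  ∈-sublists-⊆ (x ∷ xs) ys∈ y∈ with ∈-++⁻ (sublists xs) ys∈
  ... | inj₁ ys∈′ = there (∈-sublists-⊆ xs ys∈′ y∈)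
  ... | inj₂ xys∈ with ∈-map⁻ (x ∷_) xys∈
  ...   | _ , ys∈′ , refl with y∈
  ...     | here refl = here refl
  ...     | there y∈′ = there (∈-sublists-⊆ xs ys∈′ y∈′)

module Edges (n : ℕ) where

  -- Ordering the two ends lets both orientations of an edge share one coordinate, so that a graph
  -- is read off from `n * n` independent bits.
  code : Fin n → Fin n → Fin (n * n)
  code i j with toℕ i ≤? toℕ j
  ... | yes _ = combine i j
  ... | no _  = combine j i

  code-sym : ∀ i j → code i j ≡ code j i
  code-sym i j with toℕ i ≤? toℕ j | toℕ j ≤? toℕ i
  ... | yes i≤j | yes j≤i = cong₂ combine i≡j (sym i≡j)
    where
    i≡j : i ≡ j
    i≡j = toℕ-injective (≤-antisym i≤j j≤i)
  ... | yes _   | no _    = refl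
  ... | no _    | yes _   = refl
  ... | no i≰j  | no j≰i  = contradiction (<⇒≤ (≰⇒> i≰j)) j≰i

  code-injective : ∀ i j k l → code i j ≡ code k l → (i ≡ k × j ≡ l) ⊎ (i ≡ l × j ≡ k)
  code-injective i j k l eq with toℕ i ≤? toℕ j | toℕ k ≤? toℕ l
  ... | yes _ | yes _ = inj₁ (combine-injective i j k l eq)
  ... | yes _ | no _  = inj₂ (combine-injective i j l k eq)
  ... | no _  | yes _ = let a , b = combine-injective j i k l eq in inj₂ (b , a)
  ... | no _  | no _  = let a , b = combine-injective j i l k eq in inj₁ (b , a)

  code-injectiveʳ : ∀ i {j l} → code i j ≡ code i l → j ≡ l
  code-injectiveʳ i {j} {l} eq with code-injective i j i l eq
  ... | inj₁ (_ , j≡l)   = j≡l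
  ... | inj₂ (i≡l , j≡i) = trans j≡i i≡l

  pairs : List (Fin n) → List (Fin (n * n))
  pairs []       = []
  pairs (x ∷ xs) = map (code x) xs ++ pairs xs

  length-pairs : ∀ xs → length (pairs xs) ≡ tri (length xs)
  length-pairs []       = refl
  length-pairs (x ∷ xs) = trans (length-++ (map (code x) xs)) (cong₂ _+_ (length-map (code x) xs) (length-pairs xs))

  ∈-pairs⁻ : ∀ {xs c} → Unique xs → c ∈ pairs xs → ∃₂ λ a b → a ∈ xs × b ∈ xs × a ≢ b × c ≡ code a b
  ∈-pairs⁻ {x ∷ xs} (x∉ ∷ u) c∈ with ∈-++⁻ (map (code x) xs) c∈
  ... | inj₁ c∈map = let b , b∈ , eq = ∈-map⁻ (code x) c∈map in
                     x , b , here refl , there b∈ , All.lookup x∉ b∈ , eq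
  ... | inj₂ c∈′   = let a , b , a∈ , b∈ , a≢b , eq = ∈-pairs⁻ u c∈′ in
                     a , b , there a∈ , there b∈ , a≢b , eq

  pairs-unique : ∀ {xs} → Unique xs → Unique (pairs xs)
  pairs-unique []                = []
  pairs-unique {x ∷ xs} (x∉ ∷ u) = Uniqueₚ.++⁺ (Uniqueₚ.map⁺ (code-injectiveʳ x) u) (pairs-unique u)
    λ (c∈map , c∈pairs) →
      let b , _ , eq = ∈-map⁻ (code x) c∈map
          c , d , c∈ , d∈ , _ , eq′ = ∈-pairs⁻ u c∈pairs
      in [ (λ (x≡c , _) → All.lookup x∉ c∈ x≡c) , (λ (x≡d , _) → All.lookup x∉ d∈ x≡d) ]
         (code-injective x b c d (trans (sym eq) eq′))

  tuples : ℕ → List (List (Fin n))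
  tuples zero    = [] ∷ []
  tuples (suc w) = concatMap (λ x → map (x ∷_) (tuples w)) (allFin n)

  ∈-tuples : ∀ xs → xs ∈ tuples (length xs)
  ∈-tuples []       = here refl
  ∈-tuples (x ∷ xs) = ∈-concatMap⁺ (λ x → map (x ∷_) (tuples (length xs))) (lose (∈-allFin x) (∈-map⁺ (x ∷_) (∈-tuples xs)))

  ∈-tuples-length : ∀ w {xs} → xs ∈ tuples w → length xs ≡ w
  ∈-tuples-length zero    (here refl) = refl
  ∈-tuples-length (suc w) xs∈ with find (∈-concatMap⁻ (λ x → map (x ∷_) (tuples w)) {xs = allFin n} xs∈)
  ... | x , _ , xs∈′ with ∈-map⁻ (x ∷_) xs∈′
  ...   | _ , ys∈ , refl = cong suc (∈-tuples-length w ys∈)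

  ∑-tuples : ∀ w f → ∑ (tuples (suc w)) f ≡ ∑ (allFin n) (λ x → ∑ (tuples w) (λ xs → f (x ∷ xs)))
  ∑-tuples w f = trans (∑-concatMap (λ x → map (x ∷_) (tuples w)) (allFin n) f)
                       (∑-cong (allFin n) (λ {x} _ → ∑-map (x ∷_) (tuples w) f))

  |allFin| : length (allFin n) ≡ n
  |allFin| = length-tabulate {n = n} (λ i → i)

  length-tuples : ∀ w → length (tuples w) ≡ n ^ w
  length-tuples zero    = refl
  length-tuples (suc w) = begin
    length (tuples (suc w))                                ≡⟨ ∑-1 (tuples (suc w)) ⟨
    ∑ (tuples (suc w)) (λ _ → 1)                           ≡⟨ ∑-tuples w (λ _ → 1) ⟩
    ∑ (allFin n) (λ _ → ∑ (tuples w) (λ _ → 1))            ≡⟨ ∑-const (allFin n) _ ⟩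
    length (allFin n) * ∑ (tuples w) (λ _ → 1)             ≡⟨ cong₂ _*_ |allFin| (trans (∑-1 (tuples w)) (length-tuples w)) ⟩
    n * n ^ w                                              ∎
    where open ≡-Reasoning

  module Hits (inS : Fin n → ℕ) where

    σ : ℕ
    σ = ∑ (allFin n) inS

    one : List (Fin n) → ℕ
    one W = ∑ W inS

    -- The number of pairs of positions with both entries in the set. It is positive once `W` shares
    -- an edge with the set, and so dominates the indicator of `meets`.
    two : List (Fin n) → ℕ
    two []      = 0
    two (x ∷ W) = inS x * one W + two W

    ∑-one-suc : ∀ w → ∑ (tuples (suc w)) one ≡ σ * n ^ w + n * ∑ (tuples w) one
    ∑-one-suc w = begin
      ∑ (tuples (suc w)) one                                            ≡⟨ ∑-tuples w one ⟩
      ∑ (allFin n) (λ x → ∑ (tuples w) (λ W → inS x + one W))           ≡⟨ ∑-cong (allFin n) (λ {x} _ → trans (∑-+ (tuples w) _ _)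
                                                                             (cong (_+ ∑ (tuples w) one) (trans (∑-const (tuples w) (inS x)) (trans (cong (_* inS x) (length-tuples w)) (*-comm (n ^ w) (inS x)))))) ⟩
      ∑ (allFin n) (λ x → inS x * n ^ w + ∑ (tuples w) one)             ≡⟨ ∑-+ (allFin n) _ _ ⟩
      ∑ (allFin n) (λ x → inS x * n ^ w) + ∑ (allFin n) (λ _ → ∑ (tuples w) one)
        ≡⟨ cong₂ _+_ (trans (∑-cong (allFin n) (λ {x} _ → *-comm (inS x) (n ^ w))) (trans (∑-* (allFin n) (n ^ w) inS) (*-comm (n ^ w) σ)))
                     (trans (∑-const (allFin n) _) (cong (_* ∑ (tuples w) one) |allFin|)) ⟩
      σ * n ^ w + n * ∑ (tuples w) one                                  ∎
      where open ≡-Reasoning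

    ∑-two-suc : ∀ w → ∑ (tuples (suc w)) two ≡ σ * ∑ (tuples w) one + n * ∑ (tuples w) two
    ∑-two-suc w = begin
      ∑ (tuples (suc w)) two                                                       ≡⟨ ∑-tuples w two ⟩
      ∑ (allFin n) (λ x → ∑ (tuples w) (λ W → inS x * one W + two W))              ≡⟨ ∑-cong (allFin n) (λ {x} _ → trans (∑-+ (tuples w) _ _)
                                                                                        (cong (_+ ∑ (tuples w) two) (trans (∑-* (tuples w) (inS x) one) (*-comm (inS x) _)))) ⟩
      ∑ (allFin n) (λ x → ∑ (tuples w) one * inS x + ∑ (tuples w) two)             ≡⟨ ∑-+ (allFin n) _ _ ⟩
      ∑ (allFin n) (λ x → ∑ (tuples w) one * inS x) + ∑ (allFin n) (λ _ → ∑ (tuples w) two)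
        ≡⟨ cong₂ _+_ (trans (∑-* (allFin n) (∑ (tuples w) one) inS) (*-comm _ σ))
                     (trans (∑-const (allFin n) _) (cong (_* ∑ (tuples w) two) |allFin|)) ⟩
      σ * ∑ (tuples w) one + n * ∑ (tuples w) two                                  ∎
      where open ≡-Reasoning

    ∑-one : ∀ w → ∑ (tuples (suc w)) one ≡ suc w * σ * n ^ w
    ∑-one zero    = trans (∑-one-suc zero) (eq σ n)
      where
      eq : ∀ s n → s * 1 + n * 0 ≡ 1 * s * 1
      eq = solve-∀
    ∑-one (suc w) = trans (∑-one-suc (suc w)) (trans (cong (λ a → σ * n ^ suc w + n * a) (∑-one w)) (eq σ n (n ^ w) w))
      where
      eq : ∀ s n t w → s * (n * t) + n * ((1 + w) * s * t) ≡ (2 + w) * s * (n * t)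
      eq = solve-∀

    -- Two positions are confined to the set and `j` are free, so the sum is tri(2 + j) σ² n^j; a
    -- square replaces the binomial coefficient.
    ∑-two : ∀ j → ∑ (tuples (2 + j)) two ≤ (2 + j) * (2 + j) * (σ * σ) * n ^ j
    ∑-two zero    = ≤-cert (3 * (σ * σ)) (≤-reflexive (trans (∑-two-suc 1) (cong₂ (λ a b → σ * a + n * b) (∑-one 0) (trans (∑-two-suc 0) (eq₀ σ n))))) (eq σ n (∑ (tuples 2) two))
      where
      eq₀ : ∀ s n → s * 0 + n * 0 ≡ 0
      eq₀ = solve-∀
      eq : ∀ s n t → t + (s * (1 * s * 1) + n * 0) + 3 * (s * s) ≡ 4 * (s * s) * 1 + t
      eq = solve-∀
    ∑-two (suc j) = ≤-cert ((3 + j) * (σ * σ) * (n * n ^ j)) (+-mono-≤ (≤-reflexive (trans (∑-two-suc (2 + j)) (cong (λ a → σ * a + n * ∑ (tuples (2 + j)) two) (∑-one (suc j))))) (*-monoʳ-≤ n (∑-two j)))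
      (eq σ n (n ^ j) j (∑ (tuples (3 + j)) two) (∑ (tuples (2 + j)) two))
      where
      eq : ∀ s n t j a b → a + (s * ((2 + j) * s * (n * t)) + n * b + n * ((2 + j) * (2 + j) * (s * s) * t)) + (3 + j) * (s * s) * (n * t)
                         ≡ (3 + j) * (3 + j) * (s * s) * (n * t) + (a + n * b)
      eq = solve-∀

  module Configurations (p m τ v : ℕ) where

    open Expectation p

    -- `Dense` in terms of the number of edges: 2v(e - 1) ≥ τ(w - 2).
    denseᵇ : ℕ → ℕ → Bool
    denseᵇ w e = τ * w + 2 * v ≤ᵇ 2 * v * e + 2 * τ

    -- Tuples with repeated vertices are admitted: they only enlarge the family.
    configsOn : ℕ → List (List (Fin (n * n)))
    configsOn j = concatMap (λ W → filterᵇ (denseᵇ (3 + j) ∘ length) (sublists (pairs W))) (tuples (3 + j))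

    configs : List (List (Fin (n * n)))
    configs = concatMap configsOn (upTo m)

    maxSize : ℕ
    maxSize = tri (3 + m)

    ∈-configs : ∀ f {W} → 3 ≤ length W → length W ≤ m → denseᵇ (length W) (length (filterᵇ f (pairs W))) ≡ true →
                filterᵇ f (pairs W) ∈ configs
    ∈-configs f {W@(_ ∷ _ ∷ _ ∷ W′)} (s≤s (s≤s (s≤s _))) |W|≤m dense =
      ∈-concatMap⁺ configsOn (lose (∈-upTo⁺ (≤-trans (s≤s (m≤n+m _ 2)) |W|≤m))
        (∈-concatMap⁺ (λ V → filterᵇ (denseᵇ (length W) ∘ length) (sublists (pairs V)))
          (lose (∈-tuples W) (∈-filterᵇ⁺ (denseᵇ (length W) ∘ length) (filterᵇ∈sublists f (pairs W)) dense))))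

    configs-size : All (λ B → length B ≤ maxSize) configs
    configs-size = All.tabulate λ B∈ →
      let j , j∈ , B∈j = find (∈-concatMap⁻ configsOn {xs = upTo m} B∈)
          W , W∈ , B∈W = find (∈-concatMap⁻ (λ W → filterᵇ (denseᵇ (3 + j) ∘ length) (sublists (pairs W))) {xs = tuples (3 + j)} B∈j)
      in ≤-trans (∈-sublists-length (pairs W) (proj₁ (∈-filterᵇ⁻ (denseᵇ (3 + j) ∘ length) B∈W)))
           (≤-trans (≤-reflexive (trans (length-pairs W) (cong tri (∈-tuples-length (3 + j) W∈))))
                    (tri-mono (+-monoʳ-≤ 3 (<⇒≤ (∈-upTo⁻ j∈)))))

    -- With w = 3 + j, `sparse-enough` bounds the expected number n^(w-2) q^(1-e) of copies through
    -- a given edge by 1/Z.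
    module _ (0<n : 0 < n) (Z : ℕ)
      (sparse-enough : ∀ j e → denseᵇ (3 + j) e ≡ true → n ^ suc j * (Z * q) ≤ q ^ e)
      {S : List (Fin n)} (uS : Unique S) where

      open import Data.List.Membership.DecPropositional (Fin._≟_ {n}) using (_∈?_)

      inSᵇ : Fin n → Bool
      inSᵇ x = does (x ∈? S)

      open Hits (⟦_⟧ ∘ inSᵇ)

      inS : ∀ {x} → x ∈ S → 1 ≤ ⟦ inSᵇ x ⟧
      inS {x} x∈ with x ∈? S
      ... | yes _ = s≤s z≤n
      ... | no x∉ = contradiction x∈ x∉

      σ≤ : σ ≤ length S
      σ≤ = ≤-trans (≤-reflexive (sym (length-filterᵇ inSᵇ (allFin n))))
                   (length-⊆ Fin._≟_ (Uniqueₚ.filter⁺ _ (Uniqueₚ.allFin⁺ n)) λ {x} x∈ → in⇒∈ x (proj₂ (∈-filterᵇ⁻ inSᵇ {xs = allFin n} x∈)))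
        where
        in⇒∈ : ∀ x → inSᵇ x ≡ true → x ∈ S
        in⇒∈ x eq with x ∈? S
        ... | yes x∈ = x∈

      shared-edge : ∀ W {c} → c ∈ pairs W → c ∈ pairs S → 1 ≤ two W
      shared-edge (x ∷ W) {c} c∈ c∈S with ∈-++⁻ (map (code x) W) c∈
      ... | inj₂ c∈′ = ≤-trans (shared-edge W c∈′ c∈S) (m≤n+m _ _)
      ... | inj₁ c∈map with ∈-map⁻ (code x) c∈map | ∈-pairs⁻ uS c∈S
      ...   | y , y∈ , eq | a , b , a∈ , b∈ , _ , eq′ with code-injective x y a b (trans (sym eq) eq′)
      ...     | inj₁ (refl , refl) = ≤-trans (*-mono-≤ (inS a∈) (≤-trans (inS b∈) (∈⇒≤∑ (⟦_⟧ ∘ inSᵇ) y∈))) (m≤m+n _ _)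
      ...     | inj₂ (refl , refl) = ≤-trans (*-mono-≤ (inS b∈) (≤-trans (inS a∈) (∈⇒≤∑ (⟦_⟧ ∘ inSᵇ) y∈))) (m≤m+n _ _)

      meets≤two : ∀ W {B} → B ∈ sublists (pairs W) → ⟦ meets (pairs S) B ⟧ ≤ two W
      meets≤two W {B} B∈ with meets (pairs S) B in eq
      ... | false = z≤n
      ... | true  = let c , c∈B , c∈S = meets⁻ (pairs S) B eq in shared-edge W (∈-sublists-⊆ (pairs W) B∈ c∈B) c∈S

      weight : List (Fin (n * n)) → ℕ
      weight B = ⟦ meets (pairs S) B ⟧ * q ^ (maxSize ∸ length B)

      capacity : ℕ
      capacity = 2 ^ maxSize * ((3 + m) * (3 + m))

      -- A tuple carries at most `2 ^ maxSize` edge patterns, each of probability at most 1/(n^(w-2)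
      -- Z q), and summing `two` over the tuples gives O(s² n^(w-2)) for an s-set. Hence μ =
      -- O(s²/(Zq)), the constant being `capacity`.
      cost-configsOn : ∀ {j} → j < m → Z * q * ∑ (configsOn j) weight ≤ capacity * (length S * length S) * q ^ maxSize
      cost-configsOn {j} j<m = *-cancelˡ-≤ (n ^ suc j) ⦃ m^n≢0 n (suc j) ⦃ >-nonZero 0<n ⦄ ⦄ (begin
        n ^ suc j * (Z * q * ∑ (configsOn j) weight)
          ≡⟨ trans (sym (*-assoc (n ^ suc j) (Z * q) _)) (cong (n ^ suc j * (Z * q) *_) (∑-concatMap candidates (tuples (3 + j)) weight)) ⟩
        n ^ suc j * (Z * q) * ∑ (tuples (3 + j)) (λ W → ∑ (candidates W) weight)
          ≡⟨ trans (sym (∑-* (tuples (3 + j)) (n ^ suc j * (Z * q)) _)) (∑-cong (tuples (3 + j)) (λ {W} _ → sym (∑-* (candidates W) (n ^ suc j * (Z * q)) weight))) ⟩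
        ∑ (tuples (3 + j)) (λ W → ∑ (candidates W) (λ B → n ^ suc j * (Z * q) * weight B))
          ≤⟨ ∑-mono (tuples (3 + j)) (λ {W} W∈ → ≤-trans (∑-mono (candidates W) (pointwise W W∈))
               (≤-trans (≤-reflexive (∑-const (candidates W) (two W * q ^ maxSize))) (*-monoˡ-≤ (two W * q ^ maxSize) (few-candidates W W∈)))) ⟩
        ∑ (tuples (3 + j)) (λ W → 2 ^ maxSize * (two W * q ^ maxSize))
          ≡⟨ trans (∑-cong (tuples (3 + j)) (λ {W} _ → eq₁ (2 ^ maxSize) (two W) (q ^ maxSize))) (∑-* (tuples (3 + j)) (2 ^ maxSize * q ^ maxSize) two) ⟩
        2 ^ maxSize * q ^ maxSize * ∑ (tuples (3 + j)) two
          ≤⟨ *-monoʳ-≤ (2 ^ maxSize * q ^ maxSize) (≤-trans (∑-two (suc j))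
               (*-monoˡ-≤ (n ^ suc j) (*-mono-≤ (*-mono-≤ 3+j≤ 3+j≤) (*-mono-≤ σ≤ σ≤)))) ⟩
        2 ^ maxSize * q ^ maxSize * ((3 + m) * (3 + m) * (length S * length S) * n ^ suc j)
          ≡⟨ eq₂ (2 ^ maxSize) (q ^ maxSize) (3 + m) (length S) (n ^ suc j) ⟩
        n ^ suc j * (capacity * (length S * length S) * q ^ maxSize) ∎)
        where
        open ≤-Reasoning
        candidates : List (Fin n) → List (List (Fin (n * n)))
        candidates W = filterᵇ (denseᵇ (3 + j) ∘ length) (sublists (pairs W))
        3+j≤ : 3 + j ≤ 3 + m
        3+j≤ = +-monoʳ-≤ 3 (<⇒≤ j<m)
        |pairs| : ∀ W → W ∈ tuples (3 + j) → length (pairs W) ≤ maxSize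
        |pairs| W W∈ = ≤-trans (≤-reflexive (trans (length-pairs W) (cong tri (∈-tuples-length (3 + j) W∈)))) (tri-mono 3+j≤)
        few-candidates : ∀ W → W ∈ tuples (3 + j) → length (candidates W) ≤ 2 ^ maxSize
        few-candidates W W∈ = ≤-trans (length-filter _ (sublists (pairs W)))
          (≤-trans (≤-reflexive (length-sublists (pairs W))) (^-monoʳ-≤ 2 (|pairs| W W∈)))
        pointwise : ∀ W → W ∈ tuples (3 + j) → ∀ {B} → B ∈ candidates W → n ^ suc j * (Z * q) * weight B ≤ two W * q ^ maxSize
        pointwise W W∈ {B} B∈ =
          let B∈sub , dense = ∈-filterᵇ⁻ (denseᵇ (3 + j) ∘ length) {xs = sublists (pairs W)} B∈
              |B|≤ = ≤-trans (∈-sublists-length (pairs W) B∈sub) (|pairs| W W∈)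
          in begin
          n ^ suc j * (Z * q) * (⟦ meets (pairs S) B ⟧ * q ^ (maxSize ∸ length B))
            ≤⟨ *-mono-≤ (sparse-enough j (length B) dense) (*-monoˡ-≤ _ (meets≤two W B∈sub)) ⟩
          q ^ length B * (two W * q ^ (maxSize ∸ length B))
            ≡⟨ eq₀ (q ^ length B) (two W) (q ^ (maxSize ∸ length B)) ⟩
          two W * (q ^ length B * q ^ (maxSize ∸ length B))
            ≡⟨ cong (two W *_) (trans (sym (^-distribˡ-+-* q (length B) _)) (cong (q ^_) (m+[n∸m]≡n |B|≤))) ⟩
          two W * q ^ maxSize ∎
          where
          eq₀ : ∀ a b c → a * (b * c) ≡ b * (a * c)
          eq₀ = solve-∀
        eq₁ : ∀ a b c → a * (b * c) ≡ a * c * b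
        eq₁ = solve-∀
        eq₂ : ∀ a b c d e → a * b * (c * c * (d * d) * e) ≡ e * (a * (c * c) * (d * d) * b)
        eq₂ = solve-∀

      cost-configs : Z * q * cost maxSize (filterᵇ (meets (pairs S)) configs) ≤ m * capacity * (length S * length S) * q ^ maxSize
      cost-configs = begin
        Z * q * cost maxSize (filterᵇ (meets (pairs S)) configs)
          ≡⟨ cong (Z * q *_) (trans (∑-filterᵇ (meets (pairs S)) configs _) (∑-concatMap configsOn (upTo m) weight)) ⟩
        Z * q * ∑ (upTo m) (λ j → ∑ (configsOn j) weight)
          ≡⟨ ∑-* (upTo m) (Z * q) _ ⟨
        ∑ (upTo m) (λ j → Z * q * ∑ (configsOn j) weight)
          ≤⟨ ∑-mono (upTo m) (λ j∈ → cost-configsOn (∈-upTo⁻ j∈)) ⟩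
        ∑ (upTo m) (λ _ → capacity * (length S * length S) * q ^ maxSize)
          ≡⟨ trans (∑-const (upTo m) _) (cong (_* (capacity * (length S * length S) * q ^ maxSize)) (length-upTo m)) ⟩
        m * (capacity * (length S * length S) * q ^ maxSize)
          ≡⟨ eq m capacity (length S * length S) (q ^ maxSize) ⟩
        m * capacity * (length S * length S) * q ^ maxSize ∎
        where
        open ≤-Reasoning
        eq : ∀ a b c d → a * (b * c * d) ≡ a * b * c * d
        eq = solve-∀

  module Induced (y : Fin (n * n) → Bool) where

    adjacent-or-equal : Fin n → Fin n → Bool
    adjacent-or-equal i j = does (i Fin.≟ j) ∨ y (code i j)

    private nb = adjacent-or-equal

    nb-refl : ∀ i → nb i i ≡ true
    nb-refl i with i Fin.≟ i
    ... | yes _  = refl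
    ... | no i≢i = contradiction refl i≢i

    nb-sym : ∀ i j → nb i j ≡ nb j i
    nb-sym i j with i Fin.≟ j | j Fin.≟ i
    ... | yes _   | yes _   = refl
    ... | yes i≡j | no j≢i  = contradiction (sym i≡j) j≢i
    ... | no i≢j  | yes j≡i = contradiction (sym j≡i) i≢j
    ... | no _    | no _    = cong y (code-sym i j)

    open Neighbourhoods nb nb-refl nb-sym

    cdegSum-pairs : ∀ {W} → Unique W → cdegSum W ≡ 2 * length (filterᵇ y (pairs W)) + length W
    cdegSum-pairs []                = refl
    cdegSum-pairs {x ∷ W} (x∉ ∷ u) = begin
      ⟦ nb x x ⟧ + cdeg W x + ∑ W (λ z → ⟦ nb z x ⟧ + cdeg W z)
        ≡⟨ cong₂ (λ a b → a + cdeg W x + b) (cong ⟦_⟧ (nb-refl x)) (trans (∑-+ W _ _) (cong (_+ cdegSum W) (∑-cong W (λ {z} _ → cong ⟦_⟧ (nb-sym z x))))) ⟩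
      1 + cdeg W x + (cdeg W x + cdegSum W)
        ≡⟨ cong₂ (λ a b → 1 + a + (a + b)) outer (cdegSum-pairs u) ⟩
      1 + ∑ (map (code x) W) (⟦_⟧ ∘ y) + (∑ (map (code x) W) (⟦_⟧ ∘ y) + (2 * length (filterᵇ y (pairs W)) + length W))
        ≡⟨ eq (∑ (map (code x) W) (⟦_⟧ ∘ y)) (length (filterᵇ y (pairs W))) (length W) ⟩
      2 * (∑ (map (code x) W) (⟦_⟧ ∘ y) + length (filterᵇ y (pairs W))) + suc (length W)
        ≡⟨ cong (λ a → 2 * a + suc (length W)) split ⟨
      2 * length (filterᵇ y (pairs (x ∷ W))) + suc (length W) ∎
      where
      open ≡-Reasoning
      eq : ∀ a b c → 1 + a + (a + (2 * b + c)) ≡ 2 * (a + b) + (1 + c)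
      eq = solve-∀
      outer : cdeg W x ≡ ∑ (map (code x) W) (⟦_⟧ ∘ y)
      outer = trans (∑-cong W (λ {z} z∈ → cong ⟦_⟧ (distinct z (All.lookup x∉ z∈)))) (sym (∑-map (code x) W (⟦_⟧ ∘ y)))
        where
        distinct : ∀ z → x ≢ z → nb x z ≡ y (code x z)
        distinct z x≢z with x Fin.≟ z
        ... | yes x≡z = contradiction x≡z x≢z
        ... | no _    = refl
      split : length (filterᵇ y (pairs (x ∷ W))) ≡ ∑ (map (code x) W) (⟦_⟧ ∘ y) + length (filterᵇ y (pairs W))
      split = trans (length-filterᵇ y (pairs (x ∷ W))) (trans (∑-++ (map (code x) W) (pairs W) _)
                (cong (∑ (map (code x) W) (⟦_⟧ ∘ y) +_) (sym (length-filterᵇ y (pairs W)))))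

-- Estimates for powers and factorials

^-distribʳ-* : ∀ k a b → (a * b) ^ k ≡ a ^ k * b ^ k
^-distribʳ-* zero    a b = refl
^-distribʳ-* (suc k) a b = trans (cong (a * b *_) (^-distribʳ-* k a b)) (eq a b (a ^ k) (b ^ k))
  where
  eq : ∀ a b c d → a * b * (c * d) ≡ a * c * (b * d)
  eq = solve-∀

^-cancel : ∀ {a b} c n .⦃ _ : NonZero c ⦄ → c ^ n * a ≤ c ^ n * b → a ≤ b
^-cancel c n = *-cancelˡ-≤ (c ^ n) ⦃ m^n≢0 c n ⦄

-- The last `J` factors of the factorial are at least `s`; this takes the place of Stirling's
-- formula.
!-≥ : ∀ s J → s ^ J ≤ (s + J) !
!-≥ s zero    = 1≤n! (s + 0)
!-≥ s (suc J) = subst (λ n → s * s ^ J ≤ n !) (sym (+-suc s J)) (*-mono-≤ (≤-trans (m≤m+n s J) (n≤1+n (s + J))) (!-≥ s J))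

2*tri : ∀ s → 2 * tri (suc s) ≡ suc s * s
2*tri zero    = refl
2*tri (suc s) = trans (eq s (tri (suc s))) (trans (cong (2 * suc s +_) (2*tri s)) (eq′ s))
  where
  eq : ∀ s t → 2 * (1 + s + t) ≡ 2 * (1 + s) + 2 * t
  eq = solve-∀
  eq′ : ∀ s → 2 * (1 + s) + (1 + s) * s ≡ (2 + s) * (1 + s)
  eq′ = solve-∀

bernoulli : ∀ P k → P ^ k + k * P ^ pred k ≤ suc P ^ k
bernoulli P zero          = ≤-refl
bernoulli P (suc zero)    = ≤-reflexive (eq P)
  where
  eq : ∀ P → P * 1 + 1 ≡ (1 + P) * 1
  eq = solve-∀
bernoulli P (suc (suc k)) = ≤-trans (≤-cert (suc k * P ^ k) ≤-refl (eq P (P ^ k) k)) (*-monoʳ-≤ (suc P) (bernoulli P (suc k)))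
  where
  eq : ∀ P t k → P * (P * t) + (2 + k) * (P * t) + 0 + (1 + k) * t ≡ (1 + P) * (P * t + (1 + k) * t) + 0
  eq = solve-∀

-- (1 − 1/Q)^Q ≤ 1/2
halving : ∀ P → 2 * P ^ suc P ≤ suc P ^ suc P
halving P = ≤-trans (≤-cert (P ^ P) ≤-refl (eq P (P ^ P))) (bernoulli P (suc P))
  where
  eq : ∀ P t → 2 * (P * t) + 0 + t ≡ P * t + (1 + P) * t + 0
  eq = solve-∀

-- The `N` factors contain `y` blocks of length `suc P`, and each block gives one halving.
halving-^ : ∀ P y N → suc P * y ≤ N → 2 ^ y * P ^ N ≤ suc P ^ N
halving-^ P y N le = begin
  2 ^ y * P ^ N                                   ≡⟨ cong (λ a → 2 ^ y * P ^ a) N≡ ⟨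
  2 ^ y * P ^ (suc P * y + (N ∸ suc P * y))       ≡⟨ cong (2 ^ y *_) (^-distribˡ-+-* P (suc P * y) _) ⟩
  2 ^ y * (P ^ (suc P * y) * P ^ r)               ≡⟨ cong (λ a → 2 ^ y * (a * P ^ r)) (^-*-assoc P (suc P) y) ⟨
  2 ^ y * ((P ^ suc P) ^ y * P ^ r)               ≡⟨ *-assoc (2 ^ y) _ _ ⟨
  2 ^ y * (P ^ suc P) ^ y * P ^ r                 ≡⟨ cong (_* P ^ r) (^-distribʳ-* y 2 (P ^ suc P)) ⟨
  (2 * P ^ suc P) ^ y * P ^ r                     ≤⟨ *-mono-≤ (^-monoˡ-≤ y (halving P)) (^-monoˡ-≤ r (n≤1+n P)) ⟩
  (suc P ^ suc P) ^ y * suc P ^ r                 ≡⟨ cong (_* suc P ^ r) (^-*-assoc (suc P) (suc P) y) ⟩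
  suc P ^ (suc P * y) * suc P ^ r                 ≡⟨ ^-distribˡ-+-* (suc P) (suc P * y) r ⟨
  suc P ^ (suc P * y + r)                         ≡⟨ cong (suc P ^_) N≡ ⟩
  suc P ^ N                                       ∎
  where
  open ≤-Reasoning
  r = N ∸ suc P * y
  N≡ : suc P * y + r ≡ N
  N≡ = m+[n∸m]≡n le

-- The random graph and its two union bounds

module RandomGraph (n m τ v D i z p Y : ℕ)
  (0<v : 0 < v)
  (q≡ : suc p ≡ z ^ i)
  (i-large : 2 * v * (D + 4) ≤ i * τ)
  (0<n : 0 < n) (n≤ : n ≤ z ^ suc D)
  (4≤z : 4 ≤ z)
  (z-large : m * (2 ^ tri (3 + m) * ((3 + m) * (3 + m))) ≤ z)
  (4Y<z : 4 * Y < z)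
  (Y-large : z ^ (2 + D + (D + i + 3) * tri (3 + m)) ≤ 2 ^ Y)
  where

  open Expectation p
  open Edges n
  open Configurations p m τ v
  open ≤-Reasoning

  s J M N K : ℕ
  s = z ^ suc i
  J = s * (D + i + 3)
  M = tri (3 + m)
  N = tri s
  K = n ^ s

  instance
    z≢0 : NonZero z
    z≢0 = >-nonZero (≤-trans (s≤s z≤n) 4≤z)
    s≢0 : NonZero s
    s≢0 = m^n≢0 z (suc i)

  s≡zq : s ≡ z * q
  s≡zq = cong (z *_) (sym q≡)

  z≤z^s : z ≤ z ^ s
  z≤z^s = ≤-trans (≤-reflexive (sym (*-identityʳ z))) (^-monoʳ-≤ z (>-nonZero⁻¹ s))

  -- In exponents of `z`: each of w - 2 vertices costs at most D + 1 and the factor z³ costs 3, in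
  -- total at most (D + 4)(w - 2). Density and `i-large` turn this into at most i(e - 1).
  sparse-enough : ∀ j e → denseᵇ (3 + j) e ≡ true → n ^ suc j * (z ^ 3 * q) ≤ q ^ e
  sparse-enough j e dense = go e (≤-cert 0 (≤ᵇ-true⁻¹ dense) (eq τ v j e))
    where
    eq : ∀ τ v j e → τ * (1 + j) + 2 * v + (2 * v * e + 2 * τ) + 0 ≡ 2 * v * e + (τ * (3 + j) + 2 * v)
    eq = solve-∀
    go : ∀ e → τ * suc j + 2 * v ≤ 2 * v * e → n ^ suc j * (z ^ 3 * q) ≤ q ^ e
    go zero le = contradiction (≤-trans (m≤n+m (2 * v) (τ * suc j)) (≤-trans le (≤-reflexive (*-zeroʳ (2 * v))))) (<⇒≱ (*-mono-≤ {1} {2} (s≤s z≤n) 0<v))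
    go (suc e) le = begin
      n ^ suc j * (z ^ 3 * q)                     ≡⟨ *-assoc (n ^ suc j) (z ^ 3) q ⟨
      n ^ suc j * z ^ 3 * q                       ≤⟨ *-monoˡ-≤ q (*-monoˡ-≤ (z ^ 3) (^-monoˡ-≤ (suc j) n≤)) ⟩
      (z ^ suc D) ^ suc j * z ^ 3 * q             ≡⟨ cong (λ a → a * z ^ 3 * q) (^-*-assoc z (suc D) (suc j)) ⟩
      z ^ (suc D * suc j) * z ^ 3 * q             ≡⟨ cong (_* q) (^-distribˡ-+-* z (suc D * suc j) 3) ⟨
      z ^ (suc D * suc j + 3) * q                 ≤⟨ *-monoˡ-≤ q (^-monoʳ-≤ z (≤-trans exp₁ exp₂)) ⟩
      z ^ (i * e) * q                             ≡⟨ cong (_* q) (trans (sym (^-*-assoc z i e)) (cong (_^ e) (sym q≡))) ⟩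
      q ^ e * q                                   ≡⟨ *-comm (q ^ e) q ⟩
      q ^ suc e                                   ∎
      where
      exp₁ : suc D * suc j + 3 ≤ (D + 4) * suc j
      exp₁ = ≤-cert (3 * j) ≤-refl (eq₁ D j)
        where
        eq₁ : ∀ D j → (1 + D) * (1 + j) + 3 + 0 + 3 * j ≡ (D + 4) * (1 + j) + 0
        eq₁ = solve-∀
      exp₂ : (D + 4) * suc j ≤ i * e
      exp₂ = *-cancelˡ-≤ (2 * v) ⦃ >-nonZero (*-mono-≤ {1} {2} (s≤s z≤n) 0<v) ⦄ (begin
        2 * v * ((D + 4) * suc j)    ≡⟨ *-assoc (2 * v) (D + 4) (suc j) ⟨
        2 * v * (D + 4) * suc j      ≤⟨ *-monoˡ-≤ (suc j) i-large ⟩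
        i * τ * suc j                ≡⟨ *-assoc i τ (suc j) ⟩
        i * (τ * suc j)              ≤⟨ *-monoʳ-≤ i (≤-cert 0 le (eq₂ τ v j e)) ⟩
        i * (2 * v * e)              ≡⟨ eq₃ i v e ⟩
        2 * v * (i * e)              ∎)
        where
        eq₂ : ∀ τ v j e → τ * (1 + j) + 2 * v * (1 + e) + 0 ≡ 2 * v * e + (τ * (1 + j) + 2 * v)
        eq₂ = solve-∀
        eq₃ : ∀ i v e → i * (2 * v * e) ≡ 2 * v * (i * e)
        eq₃ = solve-∀

  n^s-bound : 4 * K ≤ z ^ (s * (D + 2))
  n^s-bound = begin
    4 * n ^ s                    ≤⟨ *-mono-≤ (≤-trans 4≤z z≤z^s) (^-monoˡ-≤ s n≤) ⟩
    z ^ s * (z ^ suc D) ^ s      ≡⟨ cong (z ^ s *_) (^-*-assoc z (suc D) s) ⟩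
    z ^ s * z ^ (suc D * s)      ≡⟨ ^-distribˡ-+-* z s (suc D * s) ⟨
    z ^ (s + suc D * s)          ≡⟨ cong (z ^_) (eq s D) ⟩
    z ^ (s * (D + 2))            ∎
    where
    eq : ∀ s D → s + (1 + D) * s ≡ s * (D + 2)
    eq = solve-∀

  -- The union bound over the n^s sets S costs n^s, and μ^J / J! with μ ≤ s/z is at most s^s / z^J, as J! ≥ s^(J − s); hence J.
  few-packings : ∀ {S} → Unique S → length S ≡ s → 4 * (K * 𝔼 (packings J (filterᵇ (meets (pairs S)) configs) [])) ≤ q ^ (n * n)
  few-packings {S} uS |S| = ^-cancel s s (begin
    s ^ s * (4 * (K * E))                 ≡⟨ eq₁ (s ^ s) K E ⟩
    4 * K * s ^ s * E                     ≤⟨ *-monoˡ-≤ E (*-monoˡ-≤ (s ^ s) n^s-bound) ⟩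
    z ^ (s * (D + 2)) * s ^ s * E         ≡⟨ cong (λ a → z ^ (s * (D + 2)) * a * E) (^-*-assoc z (suc i) s) ⟩
    z ^ (s * (D + 2)) * z ^ (suc i * s) * E ≡⟨ cong (_* E) (^-distribˡ-+-* z (s * (D + 2)) (suc i * s)) ⟨
    z ^ (s * (D + 2) + suc i * s) * E     ≡⟨ cong (λ a → z ^ a * E) (eq₂ s D i) ⟩
    z ^ J * E                             ≤⟨ ^-cancel s J′ without-factorial ⟩
    s ^ s * q ^ (n * n)                   ∎)
    where
    E = 𝔼 (packings J (filterᵇ (meets (pairs S)) configs) [])
    c = cost M (filterᵇ (meets (pairs S)) configs)
    J′ = s * (D + i + 2)
    J≡ : s + J′ ≡ J
    J≡ = eq s D i
      where
      eq : ∀ s D i → s + s * (D + i + 2) ≡ s * (D + i + 3)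
      eq = solve-∀
    eq₁ : ∀ a k e → a * (4 * (k * e)) ≡ 4 * k * a * e
    eq₁ = solve-∀
    eq₂ : ∀ s D i → s * (D + 2) + (1 + i) * s ≡ s * (D + i + 3)
    eq₂ = solve-∀
    -- Here Z = z³ is spent: one factor absorbs the constant, one the quotient s/q, and the third is
    -- the gain μ ≤ s/z.
    z*cost : z * c ≤ s * q ^ M
    z*cost = *-cancelˡ-≤ (z * z * q) ⦃ m*n≢0 (z * z) q ⦃ m*n≢0 z z ⦄ ⦄ (begin
      z * z * q * (z * c)                 ≡⟨ eq₃ z q c ⟩
      z ^ 3 * q * c                       ≤⟨ cost-configs 0<n (z ^ 3) sparse-enough uS ⟩
      m * (2 ^ M * ((3 + m) * (3 + m))) * (length S * length S) * q ^ M
                                          ≤⟨ *-monoˡ-≤ (q ^ M) (*-mono-≤ z-large (≤-reflexive (cong₂ _*_ (trans |S| s≡zq) |S|))) ⟩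
      z * (z * q * s) * q ^ M             ≡⟨ eq₄ z q s (q ^ M) ⟩
      z * z * q * (s * q ^ M)             ∎)
      where
      eq₃ : ∀ z q c → z * z * q * (z * c) ≡ z * (z * (z * 1)) * q * c
      eq₃ = solve-∀
      eq₄ : ∀ z q s t → z * (z * q * s) * t ≡ z * z * q * (s * t)
      eq₄ = solve-∀
    without-factorial : s ^ J′ * (z ^ J * E) ≤ s ^ J′ * (s ^ s * q ^ (n * n))
    without-factorial = begin
      s ^ J′ * (z ^ J * E)                       ≤⟨ *-monoˡ-≤ (z ^ J * E) (!-≥ s J′) ⟩
      (s + J′) ! * (z ^ J * E)                   ≡⟨ cong (λ a → a ! * (z ^ J * E)) J≡ ⟩
      J ! * (z ^ J * E)                          ≤⟨ *-cancelˡ-≤ ((q ^ M) ^ J) ⦃ m^n≢0 (q ^ M) J ⦃ m^n≢0 q M ⦄ ⦄ scaled ⟩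
      q ^ (n * n) * s ^ J                        ≡⟨ cong (λ a → q ^ (n * n) * s ^ a) J≡ ⟨
      q ^ (n * n) * s ^ (s + J′)                 ≡⟨ cong (q ^ (n * n) *_) (^-distribˡ-+-* s s J′) ⟩
      q ^ (n * n) * (s ^ s * s ^ J′)             ≡⟨ eq₅ (q ^ (n * n)) (s ^ s) (s ^ J′) ⟩
      s ^ J′ * (s ^ s * q ^ (n * n))             ∎
      where
      eq₅ : ∀ a b c → a * (b * c) ≡ c * (b * a)
      eq₅ = solve-∀
      scaled : (q ^ M) ^ J * (J ! * (z ^ J * E)) ≤ (q ^ M) ^ J * (q ^ (n * n) * s ^ J)
      scaled = begin
        (q ^ M) ^ J * (J ! * (z ^ J * E))          ≡⟨ eq₆ ((q ^ M) ^ J) (J !) (z ^ J) E ⟩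
        z ^ J * (J ! * (E * (1 * (q ^ M) ^ J)))    ≤⟨ *-monoʳ-≤ (z ^ J) (𝔼-packings M J (filterᵇ (meets (pairs S)) configs) [] (Allₚ.filter⁺ _ configs-size)) ⟩
        z ^ J * (q ^ (n * n) * c ^ J)              ≡⟨ eq₇ (z ^ J) (q ^ (n * n)) (c ^ J) ⟩
        q ^ (n * n) * (z ^ J * c ^ J)              ≡⟨ cong (q ^ (n * n) *_) (^-distribʳ-* J z c) ⟨
        q ^ (n * n) * (z * c) ^ J                  ≤⟨ *-monoʳ-≤ (q ^ (n * n)) (^-monoˡ-≤ J z*cost) ⟩
        q ^ (n * n) * (s * q ^ M) ^ J              ≡⟨ cong (q ^ (n * n) *_) (^-distribʳ-* J s (q ^ M)) ⟩
        q ^ (n * n) * (s ^ J * (q ^ M) ^ J)        ≡⟨ eq₈ (q ^ (n * n)) (s ^ J) ((q ^ M) ^ J) ⟩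
        (q ^ M) ^ J * (q ^ (n * n) * s ^ J)        ∎
        where
        eq₆ : ∀ a b c d → a * (b * (c * d)) ≡ c * (b * (d * (1 * a)))
        eq₆ = solve-∀
        eq₇ : ∀ a b c → a * (b * c) ≡ b * (a * c)
        eq₇ = solve-∀
        eq₈ : ∀ a b c → a * (b * c) ≡ c * (a * b)
        eq₈ = solve-∀

  -- A pair multiplies the mean of `soft` by (2q - 1)/q, which relative to 2^N gives (1 - 1/(2q))^N.
  -- With about s²/2 = szq/2 pairs this is at most 2^(-sY) for Y below z/4, enough against 4K ·
  -- 2^(JM), which is at most a power of z with exponent linear in s.
  few-sparse : ∀ {S} → Unique S → length S ≡ s → 4 * (K * (2 ^ (J * M) * 𝔼 (soft (pairs S)))) ≤ q ^ (n * n) * 2 ^ N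
  few-sparse {S} uS |S| = ^-cancel q N (begin
    q ^ N * (4 * (K * (2 ^ (J * M) * E)))           ≡⟨ eq₁ (q ^ N) K (2 ^ (J * M)) E ⟩
    4 * K * 2 ^ (J * M) * (q ^ N * E)               ≡⟨ cong (4 * K * 2 ^ (J * M) *_) 𝔼-soft ⟩
    4 * K * 2 ^ (J * M) * (P ^ N * q ^ (n * n))     ≤⟨ *-monoˡ-≤ (P ^ N * q ^ (n * n)) union ⟩
    2 ^ (s * Y) * (P ^ N * q ^ (n * n))             ≡⟨ *-assoc (2 ^ (s * Y)) _ _ ⟨
    2 ^ (s * Y) * P ^ N * q ^ (n * n)               ≤⟨ *-monoˡ-≤ (q ^ (n * n)) (halving-^ P (s * Y) N enough-pairs) ⟩
    suc P ^ N * q ^ (n * n)                         ≡⟨ cong (λ a → a ^ N * q ^ (n * n)) (eq₂ p) ⟩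
    (q * 2) ^ N * q ^ (n * n)                       ≡⟨ cong (_* q ^ (n * n)) (^-distribʳ-* N q 2) ⟩
    q ^ N * 2 ^ N * q ^ (n * n)                     ≡⟨ eq₃ (q ^ N) (2 ^ N) (q ^ (n * n)) ⟩
    q ^ N * (q ^ (n * n) * 2 ^ N)                   ∎)
    where
    E = 𝔼 (soft (pairs S))
    P = 1 + p * 2
    eq₁ : ∀ a k b e → a * (4 * (k * (b * e))) ≡ 4 * k * b * (a * e)
    eq₁ = solve-∀
    eq₂ : ∀ p → 1 + (1 + p * 2) ≡ (1 + p) * 2
    eq₂ = solve-∀
    eq₃ : ∀ a b c → a * b * c ≡ a * (c * b)
    eq₃ = solve-∀
    |pairs| : length (pairs S) ≡ N
    |pairs| = trans (length-pairs S) (cong tri |S|)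
    𝔼-soft : q ^ N * E ≡ P ^ N * q ^ (n * n)
    𝔼-soft = subst (λ a → q ^ a * E ≡ P ^ a * q ^ (n * n)) |pairs| (𝔼-∏ _ (pairs-unique uS))
    union : 4 * K * 2 ^ (J * M) ≤ 2 ^ (s * Y)
    union = begin
      4 * K * 2 ^ (J * M)                       ≤⟨ *-mono-≤ n^s-bound (^-monoˡ-≤ (J * M) (≤-trans (s≤s (s≤s z≤n)) 4≤z)) ⟩
      z ^ (s * (D + 2)) * z ^ (J * M)           ≡⟨ ^-distribˡ-+-* z (s * (D + 2)) (J * M) ⟨
      z ^ (s * (D + 2) + J * M)                 ≡⟨ cong (z ^_) (eq s D (D + i + 3) M) ⟩
      z ^ ((2 + D + (D + i + 3) * M) * s)       ≡⟨ ^-*-assoc z (2 + D + (D + i + 3) * M) s ⟨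
      (z ^ (2 + D + (D + i + 3) * M)) ^ s       ≤⟨ ^-monoˡ-≤ s Y-large ⟩
      (2 ^ Y) ^ s                               ≡⟨ trans (^-*-assoc 2 Y s) (cong (2 ^_) (*-comm Y s)) ⟩
      2 ^ (s * Y)                               ∎
      where
      eq : ∀ s D d M → s * (D + 2) + s * d * M ≡ (2 + D + d * M) * s
      eq = solve-∀
    -- Twice `N` is s(s - 1) and not s²; the strictness of `4Y<z` makes up for the difference.
    enough-pairs : suc P * (s * Y) ≤ N
    enough-pairs = *-cancelˡ-≤ 2 (begin
      2 * (suc P * (s * Y))      ≡⟨ cong (λ a → 2 * (a * (s * Y))) (eq₂ p) ⟩
      2 * (q * 2 * (s * Y))      ≡⟨ eq q s Y ⟩
      s * (4 * Y * q)            ≤⟨ *-monoʳ-≤ s (s≤s⁻¹ (begin-strict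
        4 * Y * q                  <⟨ *-monoˡ-< q 4Y<z ⟩
        z * q                      ≡⟨ s≡zq ⟨
        s                          ≡⟨ suc-pred s ⟨
        suc (pred s)               ∎)) ⟩
      s * pred s                 ≡⟨ cong (_* pred s) (suc-pred s) ⟨
      suc (pred s) * pred s      ≡⟨ 2*tri (pred s) ⟨
      2 * tri (suc (pred s))     ≡⟨ cong (λ a → 2 * tri a) (suc-pred s) ⟩
      2 * N                      ∎)
      where
      eq : ∀ q s Y → 2 * (q * 2 * (s * Y)) ≡ s * (4 * Y * q)
      eq = solve-∀

  open DecUnique (Fin._≟_ {n}) using (unique?)

  edge-sets : List (List (Fin (n * n)))
  edge-sets = map pairs (filter unique? (tuples s))

  ∈-edge-sets⁺ : ∀ {S} → Unique S → length S ≡ s → pairs S ∈ edge-sets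
  ∈-edge-sets⁺ {S} uS |S| = ∈-map⁺ pairs (∈-filter⁺ unique? (subst (λ w → S ∈ tuples w) |S| (∈-tuples S)) uS)

  ∈-edge-sets⁻ : ∀ {C} → C ∈ edge-sets → ∃ λ S → Unique S × length S ≡ s × C ≡ pairs S
  ∈-edge-sets⁻ C∈ =
    let S , S∈ , eq = ∈-map⁻ pairs C∈
        S∈t , uS = ∈-filter⁻ unique? {xs = tuples s} S∈
    in S , uS , ∈-tuples-length s S∈t , eq

  length-edge-sets : length edge-sets ≤ K
  length-edge-sets = ≤-trans (≤-reflexive (length-map pairs (filter unique? (tuples s))))
    (≤-trans (length-filter unique? (tuples s)) (≤-reflexive (length-tuples s)))

  random-graph : Alteration configs edge-sets
  random-graph = alteration configs edge-sets M J N K (m^n>0 n ⦃ >-nonZero 0<n ⦄ s) length-edge-sets configs-size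
    (λ C∈ → let S , uS , |S| , eq = ∈-edge-sets⁻ C∈ in
            subst (λ C → Unique C × length C ≡ N) (sym eq) (pairs-unique uS , trans (length-pairs S) (cong tri |S|)))
    (λ C∈ → let S , uS , |S| , eq = ∈-edge-sets⁻ C∈ in
            subst (λ C → 4 * (K * 𝔼 (packings J (filterᵇ (meets C) configs) [])) ≤ q ^ (n * n)) (sym eq) (few-packings uS |S|))
    (λ C∈ → let S , uS , |S| , eq = ∈-edge-sets⁻ C∈ in
            subst (λ C → 4 * (K * (2 ^ (J * M) * 𝔼 (soft C))) ≤ q ^ (n * n) * 2 ^ N) (sym eq) (few-sparse uS |S|))

-- Choice of parameters

multiple-between : ∀ τ x → 0 < τ → ∃ λ i → x ≤ i * τ × i * τ ≤ x + τ
multiple-between τ x 0<τ = suc (x / τ) , above , ≤-trans (≤-reflexive (+-comm τ _)) (+-monoˡ-≤ τ (m/n*n≤m x τ))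
  where
  instance
    τ≢0 : NonZero τ
    τ≢0 = >-nonZero 0<τ
  above : x ≤ τ + x / τ * τ
  above = ≤-trans (≤-reflexive (m≡m%n+[m/n]*n x τ)) (+-monoˡ-≤ (x / τ * τ) (<⇒≤ (m%n<n x τ)))

root : ∀ D → 0 < D → ∀ n → ∃ λ z → z ^ D ≤ n × n < suc z ^ D
root (suc D) _ zero = 0 , z≤n , ≤-reflexive (sym (^-zeroˡ (suc D)))
root (suc D) 0<D (suc n) with root (suc D) 0<D n
... | z , z^D≤n , n<  with suc z ^ suc D ≤? suc n
...   | yes le = suc z , le , ≤-<-trans n< (^-monoˡ-< (suc D) (n<1+n (suc z)))
...   | no  gt = z , m≤n⇒m≤1+n z^D≤n , ≰⇒> gt

-- Rounding the root costs a factor of at most 2^D, absorbed by one extra factor `z`.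
root-≤ : ∀ D z n → 2 ^ D ≤ z → n < suc z ^ D → n ≤ z ^ suc D
root-≤ D z n 2^D≤z n< = begin
  n                 ≤⟨ <⇒≤ n< ⟩
  suc z ^ D         ≤⟨ ^-monoˡ-≤ D (≤-trans (+-monoˡ-≤ z (≤-trans (m^n>0 2 D) 2^D≤z)) (≤-reflexive (cong (z +_) (sym (+-identityʳ z))))) ⟩
  (2 * z) ^ D       ≡⟨ ^-distribʳ-* D 2 z ⟩
  2 ^ D * z ^ D     ≤⟨ *-monoˡ-≤ (z ^ D) 2^D≤z ⟩
  z ^ suc D         ∎
  where open ≤-Reasoning

power-of-two : ∀ z → ∃ λ l → suc z ≤ 2 ^ l × 2 ^ l < 2 * suc z
power-of-two zero    = 0 , ≤-refl , ≤-refl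
power-of-two (suc z) with power-of-two z
... | l , z≤ , <2z with suc (suc z) ≤? 2 ^ l
...   | yes le = l , le , <-≤-trans <2z (*-monoʳ-≤ 2 (n≤1+n (suc z)))
...   | no  gt = suc l , ≤-trans (≤-cert z ≤-refl (eq z)) (*-monoʳ-≤ 2 z≤) , *-monoʳ-< 2 (≰⇒> gt)
  where
  eq : ∀ z → 2 + z + 0 + z ≡ 2 * (1 + z) + 0
  eq = solve-∀

n²≤2^n : ∀ j → (4 + j) * (4 + j) ≤ 2 ^ (4 + j)
n²≤2^n zero    = ≤-refl
n²≤2^n (suc j) = ≤-trans (≤-cert (j * j + 6 * j + 7) ≤-refl (eq j)) (*-monoʳ-≤ 2 (n²≤2^n j))
  where
  eq : ∀ j → (5 + j) * (5 + j) + 0 + (j * j + 6 * j + 7) ≡ 2 * ((4 + j) * (4 + j)) + 0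
  eq = solve-∀

-- `l` is the rounded-up logarithm of z + 1, and 2Bl ≤ l² ≤ 2^l < 2(z + 1). The summand 4 in the
-- threshold puts `l` in the range where l² ≤ 2^l.
logarithm : ∀ B z → 2 ^ (2 * B + 4) < suc z → ∃ λ l → suc z ≤ 2 ^ l × B * l < suc z
logarithm B z big =
  let l , z≤ , <2z = power-of-two z
      4+j≤l : 2 * B + 4 ≤ l
      4+j≤l = ≮⇒≥ λ l< → <⇒≱ big (≤-trans z≤ (^-monoʳ-≤ 2 (<⇒≤ l<)))
  in l , z≤ , *-cancelˡ-< 2 _ _ (≤-<-trans (bound l 4+j≤l) <2z)
  where
  bound : ∀ l → 2 * B + 4 ≤ l → 2 * (B * l) ≤ 2 ^ l
  bound l le = begin
    2 * (B * l)   ≡⟨ *-assoc 2 B l ⟨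
    2 * B * l     ≤⟨ *-monoˡ-≤ l (≤-trans (m≤m+n (2 * B) 4) le) ⟩
    l * l         ≡⟨ cong₂ _*_ l≡ l≡ ⟨
    (4 + j) * (4 + j) ≤⟨ n²≤2^n j ⟩
    2 ^ (4 + j)   ≡⟨ cong (2 ^_) l≡ ⟩
    2 ^ l         ∎
    where
    open ≤-Reasoning
    j = l ∸ 4
    l≡ : 4 + j ≡ l
    l≡ = m+[n∸m]≡n (≤-trans (m≤n+m 4 (2 * B)) le)

-- `Y` is `A` times a rounded logarithm, which is eventually below any fixed fraction of `z`.
growth : ∀ A → ∃ λ z₀ → ∀ z → z₀ ≤ z → ∃ λ Y → 4 * Y < z × z ^ A ≤ 2 ^ Y
growth A = suc (2 ^ (2 * (4 * A) + 4)) , λ { (suc z) big →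
  let l , z≤ , Bl< = logarithm (4 * A) z big
  in l * A , ≤-trans (≤-reflexive (cong suc (eq A l))) Bl< , ≤-trans (^-monoˡ-≤ A z≤) (≤-reflexive (^-*-assoc 2 l A)) }
  where
  eq : ∀ A l → 4 * (l * A) ≡ 4 * A * l
  eq = solve-∀

SparseGraph : (n m τ v s : ℕ) → Set
SparseGraph n m τ v s = ∃ λ (y : Fin (n * n) → Bool) →
  (∀ {W} → Unique W → 3 ≤ length W → length W ≤ m →
    ¬ τ * length W + 2 * v ≤ 2 * v * length (filterᵇ y (pairs W)) + 2 * τ) ×
  (∀ {S} → Unique S → length S ≡ s → ∃ λ c → c ∈ pairs S × y c ≡ true)
  where open Edges n

sparse-graphs : ∀ m τ v a b → 0 < τ → 0 < v → 0 < a → 0 < b →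
  ∃ λ N → ∀ n → N ≤ n → ∃ λ s → SparseGraph n m τ v s × s ^ (b * τ) ≤ n ^ (v * (2 * b + a))
sparse-graphs m τ v a b 0<τ 0<v 0<a 0<b = z₀ ^ D , λ n N≤n →
    let z , z^D≤n , n< = root D 0<D n
        z₀≤z = ≮⇒≥ λ z<z₀ → <⇒≱ n< (≤-trans (^-monoˡ-≤ D z<z₀) N≤n)
        Y , 4Y<z , Y-large = proj₂ (growth A) z (≤-trans (m≤n+m _ (4 + (2 ^ D + capacity))) (≤-trans (≤-reflexive z₀-split) z₀≤z))
    in z ^ suc i , build n z Y z^D≤n n< z₀≤z 4Y<z Y-large
  where
  -- All sizes are powers of z ≈ n^(1/D): q = z^i with i ≈ 2v(D + 4)/τ, and s = z^(i + 1); D makes (i + 1)/D ≤ (2 + a/b) v/τ.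
  D = 8 * b + 2 * (b * τ)
  0<D : 0 < D
  0<D = ≤-trans (≤-trans 0<b (m≤m+n b (7 * b))) (m≤m+n (8 * b) (2 * (b * τ)))
  multiple = multiple-between τ (2 * v * (D + 4)) 0<τ
  i = proj₁ multiple
  A = 2 + D + (D + i + 3) * tri (3 + m)
  capacity = m * (2 ^ tri (3 + m) * ((3 + m) * (3 + m)))
  z₀ = 4 + (2 ^ D + (capacity + proj₁ (growth A)))
  z₀-split : 4 + (2 ^ D + capacity) + proj₁ (growth A) ≡ z₀
  z₀-split = cong (4 +_) (+-assoc (2 ^ D) capacity _)

  -- The losses are 8bv, from the 4 in D + 4, and 2bτ, from rounding `i` up and from the extra
  -- factor `z` in s. `D` is their sum at v = 1, so Dv covers them, and the term Dva coming from the
  -- slack a/b has room for Dv.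
  exponents : suc i * (b * τ) ≤ D * (v * (2 * b + a))
  exponents = begin
    suc i * (b * τ)                                       ≡⟨ eq₀ i b τ ⟩
    b * (i * τ + τ)                                       ≤⟨ *-monoʳ-≤ b (+-monoˡ-≤ τ (proj₂ (proj₂ multiple))) ⟩
    b * (2 * v * (D + 4) + τ + τ)                         ≡⟨ eq₁ b v D τ ⟩
    2 * b * v * D + (8 * b * v + 2 * (b * τ) * 1)         ≤⟨ +-monoʳ-≤ (2 * b * v * D) (+-monoʳ-≤ (8 * b * v) (*-monoʳ-≤ (2 * (b * τ)) 0<v)) ⟩
    2 * b * v * D + (8 * b * v + 2 * (b * τ) * v)         ≡⟨ eq₂ b v D τ ⟩
    2 * b * v * D + D * v * 1                             ≤⟨ +-monoʳ-≤ (2 * b * v * D) (*-monoʳ-≤ (D * v) 0<a) ⟩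
    2 * b * v * D + D * v * a                             ≡⟨ eq₃ b v D a ⟩
    D * (v * (2 * b + a))                                 ∎
    where
    open ≤-Reasoning
    eq₀ : ∀ i b τ → (1 + i) * (b * τ) ≡ b * (i * τ + τ)
    eq₀ = solve-∀
    eq₁ : ∀ b v D τ → b * (2 * v * (D + 4) + τ + τ) ≡ 2 * b * v * D + (8 * b * v + 2 * (b * τ) * 1)
    eq₁ = solve-∀
    eq₂ : ∀ b v D τ → 2 * b * v * D + (8 * b * v + 2 * (b * τ) * v) ≡ 2 * b * v * D + (8 * b + 2 * (b * τ)) * v * 1
    eq₂ b v D τ = eq b v τ (2 * b * v * D)
      where
      eq : ∀ b v τ x → x + (8 * b * v + 2 * (b * τ) * v) ≡ x + (8 * b + 2 * (b * τ)) * v * 1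
      eq = solve-∀
    eq₃ : ∀ b v D a → 2 * b * v * D + D * v * a ≡ D * (v * (2 * b + a))
    eq₃ = solve-∀

  build : ∀ n z Y → z ^ D ≤ n → n < suc z ^ D → z₀ ≤ z → 4 * Y < z → z ^ A ≤ 2 ^ Y →
          SparseGraph n m τ v (z ^ suc i) × (z ^ suc i) ^ (b * τ) ≤ n ^ (v * (2 * b + a))
  build n z Y z^D≤n n<[1+z]^D z₀≤z 4Y<z Y-large =
    (proj₁ random-graph , sparse , λ uS |S| → proj₂ (proj₂ random-graph) (∈-edge-sets⁺ uS |S|)) , (begin
    (z ^ suc i) ^ (b * τ)                ≡⟨ ^-*-assoc z (suc i) (b * τ) ⟩
    z ^ (suc i * (b * τ))                ≤⟨ ^-monoʳ-≤ z exponents ⟩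
    z ^ (D * (v * (2 * b + a)))          ≡⟨ ^-*-assoc z D (v * (2 * b + a)) ⟨
    (z ^ D) ^ (v * (2 * b + a))          ≤⟨ ^-monoˡ-≤ (v * (2 * b + a)) z^D≤n ⟩
    n ^ (v * (2 * b + a))                ∎)
    where
    open ≤-Reasoning
    4≤z : 4 ≤ z
    4≤z = ≤-trans (m≤m+n 4 _) z₀≤z
    instance
      z≢0 : NonZero z
      z≢0 = >-nonZero (≤-trans (s≤s z≤n) 4≤z)
    rest≤z : 2 ^ D + (capacity + proj₁ (growth A)) ≤ z
    rest≤z = ≤-trans (m≤n+m _ 4) z₀≤z
    open RandomGraph n m τ v D i z (pred (z ^ i)) Y 0<v (suc-pred (z ^ i) ⦃ m^n≢0 z i ⦄) (proj₁ (proj₂ multiple))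
      (≤-trans (m^n>0 z D) z^D≤n) (root-≤ D z n (≤-trans (m≤m+n (2 ^ D) _) rest≤z) n<[1+z]^D) 4≤z
      (≤-trans (m≤m+n capacity _) (≤-trans (m≤n+m _ (2 ^ D)) rest≤z)) 4Y<z Y-large
    open Edges n
    open Configurations (pred (z ^ i)) m τ v
    y = proj₁ random-graph
    -- The alteration destroys nonempty configurations; with w ≥ 3 and τ > 0 a dense one has an
    -- edge.
    edges-needed : ∀ w e → 3 ≤ w → τ * w + 2 * v ≤ 2 * v * e + 2 * τ → 0 < e
    edges-needed w (suc e) _  _  = s≤s z≤n
    edges-needed w zero    3≤ le = contradiction le (<⇒≱ (begin-strict
      2 * v * 0 + 2 * τ   ≡⟨ cong₂ _+_ (*-zeroʳ (2 * v)) (*-comm 2 τ) ⟩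
      τ * 2               <⟨ *-monoʳ-< τ ⦃ >-nonZero 0<τ ⦄ 3≤ ⟩
      τ * w               ≤⟨ m≤m+n (τ * w) (2 * v) ⟩
      τ * w + 2 * v       ∎))
    sparse : ∀ {W} → Unique W → 3 ≤ length W → length W ≤ m →
             ¬ τ * length W + 2 * v ≤ 2 * v * length (filterᵇ y (pairs W)) + 2 * τ
    sparse {W} uW 3≤ ≤m dense = proj₁ (proj₂ random-graph) (∈-configs y {W} 3≤ ≤m (≤ᵇ-true dense))
      (Uniqueₚ.filter⁺ _ (pairs-unique uW)) (nonempty (filterᵇ y (pairs W)) (edges-needed (length W) _ 3≤ dense))
      (All.tabulate (λ c∈ → proj₂ (∈-filterᵇ⁻ y {xs = pairs W} c∈)))

-- Subsets as lists

elements : ∀ {n} → Subset n → List (Fin n)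
elements Vec.[]            = []
elements (inside  Vec.∷ S) = zero ∷ map suc (elements S)
elements (outside Vec.∷ S) = map suc (elements S)

length-elements : ∀ {n} (S : Subset n) → length (elements S) ≡ ∣ S ∣
length-elements Vec.[]            = refl
length-elements (inside  Vec.∷ S) = cong suc (trans (length-map suc (elements S)) (length-elements S))
length-elements (outside Vec.∷ S) = trans (length-map suc (elements S)) (length-elements S)

elements-unique : ∀ {n} (S : Subset n) → Unique (elements S)
elements-unique Vec.[]            = []
elements-unique (inside  Vec.∷ S) = Allₚ.map⁺ (All.tabulate (λ _ ())) ∷ Uniqueₚ.map⁺ suc-injective (elements-unique S)
elements-unique (outside Vec.∷ S) = Uniqueₚ.map⁺ suc-injective (elements-unique S)

∈-elements⁻ : ∀ {n} (S : Subset n) {i} → i ∈ elements S → i ∈ˢ S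
∈-elements⁻ (inside  Vec.∷ S) (here refl) = Vec.here
∈-elements⁻ (inside  Vec.∷ S) (there i∈) with ∈-map⁻ suc i∈
... | _ , j∈ , refl = Vec.there (∈-elements⁻ S j∈)
∈-elements⁻ (outside Vec.∷ S) i∈ with ∈-map⁻ suc i∈
... | _ , j∈ , refl = Vec.there (∈-elements⁻ S j∈)

∈-elements⁺ : ∀ {n} (S : Subset n) {i} → i ∈ˢ S → i ∈ elements S
∈-elements⁺ (inside  Vec.∷ S) Vec.here       = here refl
∈-elements⁺ (inside  Vec.∷ S) (Vec.there i∈) = there (∈-map⁺ suc (∈-elements⁺ S i∈))
∈-elements⁺ (outside Vec.∷ S) (Vec.there i∈) = ∈-map⁺ suc (∈-elements⁺ S i∈)

module _ {n : ℕ} where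

  open DecMembership (Fin._≟_ {n}) using (_∈?_)

  fromList : List (Fin n) → Subset n
  fromList xs = Vec.tabulate (λ i → does (i ∈? xs))

  ∈-fromList⁻ : ∀ xs {i} → i ∈ˢ fromList xs → i ∈ xs
  ∈-fromList⁻ xs {i} i∈ with i ∈? xs | trans (sym (lookup∘tabulate (λ i → does (i ∈? xs)) i)) ([]=⇒lookup i∈)
  ... | yes i∈xs | _  = i∈xs
  ... | no _     | ()

  ∈-fromList⁺ : ∀ xs {i} → i ∈ xs → i ∈ˢ fromList xs
  ∈-fromList⁺ xs {i} i∈ = lookup⇒[]= i (fromList xs) (trans (lookup∘tabulate (λ i → does (i ∈? xs)) i) on)
    where
    on : does (i ∈? xs) ≡ true
    on with i ∈? xs
    ... | yes _ = refl
    ... | no i∉ = contradiction i∈ i∉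

  ∣fromList∣ : ∀ {xs} → Unique xs → ∣ fromList xs ∣ ≡ length xs
  ∣fromList∣ {xs} u = trans (sym (length-elements (fromList xs))) (≤-antisym
    (length-⊆ Fin._≟_ (elements-unique (fromList xs)) (∈-fromList⁻ xs ∘ ∈-elements⁻ (fromList xs)))
    (length-⊆ Fin._≟_ u (∈-elements⁺ (fromList xs) ∘ ∈-fromList⁺ xs)))

-- The constant in front of 1/√k and the assembly of the theorem

slope : ℕ → ℕ
slope R = 2 * (leftover R * (6 * R + R * leftover R)) + leftover R * leftover R

-- For h ≥ 1, replacing h + 1 by 2h and Λ by Λh turns `missing` into (6R + RΛ)h; this is the origin
-- of `slope`.
defect-linear : ∀ R h → 1 ≤ h → defect R h ≤ slope R * h
defect-linear R (suc h) _ = ≤-cert (h * (2 * (Λ * (R * 3)) + 2 * (Λ * (R * Λ)) + Λ * Λ)) ≤-refl (eq R Λ h)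
  where
  Λ = leftover R
  eq : ∀ R Λ h → 2 * (Λ * (2 * R * (2 + h) + R * (2 + h + Λ))) + Λ * Λ + 0 + h * (2 * (Λ * (R * 3)) + 2 * (Λ * (R * Λ)) + Λ * Λ)
               ≡ (2 * (Λ * (6 * R + R * Λ)) + Λ * Λ) * (1 + h) + 0
  eq = solve-∀

square-≤ : ∀ {a b} → a * a ≤ b * b → a ≤ b
square-≤ {a} {b} le = ≮⇒≥ λ b<a → <⇒≱ (*-mono-< b<a b<a) le

-- Half of tk pays for the defect, at most `slope R` · √k, because t√k exceeds twice the slope; the
-- other half pays for 2t, as k ≥ 4. The first comparison is made between squares.
u-large : ∀ R k u v → 4 ≤ k → suc (2 * slope R) * suc (2 * slope R) * (v * v) ≤ u * u * (k * 1) →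
          ∀ h → 1 ≤ h → h * h ≤ k → v * defect R h + 2 * u ≤ u * k
u-large R k u v 4≤k u-bound h 1≤h h²≤k = *-cancelˡ-≤ 2 (begin
  2 * (v * defect R h + 2 * u)        ≡⟨ eq₁ v (defect R h) u ⟩
  2 * (v * defect R h) + u * 4        ≤⟨ +-mono-≤ (≤-trans (*-monoʳ-≤ 2 (*-monoʳ-≤ v (defect-linear R h 1≤h))) (square-≤ squared)) (*-monoʳ-≤ u 4≤k) ⟩
  u * k + u * k                       ≡⟨ cong (u * k +_) (+-identityʳ (u * k)) ⟨
  2 * (u * k)                         ∎)
  where
  open ≤-Reasoning
  C = slope R
  eq₁ : ∀ v d u → 2 * (v * d + 2 * u) ≡ 2 * (v * d) + u * 4
  eq₁ = solve-∀
  squared : 2 * (v * (C * h)) * (2 * (v * (C * h))) ≤ u * k * (u * k)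
  squared = begin
    2 * (v * (C * h)) * (2 * (v * (C * h)))              ≡⟨ eq₂ v C h ⟩
    2 * C * (2 * C) * (v * v) * (h * h)                  ≤⟨ *-mono-≤ (*-monoˡ-≤ (v * v) (*-mono-≤ (n≤1+n (2 * C)) (n≤1+n (2 * C)))) h²≤k ⟩
    suc (2 * C) * suc (2 * C) * (v * v) * k              ≤⟨ *-monoˡ-≤ k u-bound ⟩
    u * u * (k * 1) * k                                  ≡⟨ eq₃ u k ⟩
    u * k * (u * k)                                      ∎
    where
    eq₂ : ∀ v c h → 2 * (v * (c * h)) * (2 * (v * (c * h))) ≡ 2 * c * (2 * c) * (v * v) * (h * h)
    eq₂ = solve-∀
    eq₃ : ∀ u k → u * u * (k * 1) * k ≡ u * k * (u * k)
    eq₃ = solve-∀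

module PairGraph {n : ℕ} (y : Fin (n * n) → Bool) where

  open Edges n

  graph : Graph n
  graph = record
    -- The bit of a diagonal coordinate may be true, so loops are excluded by hand.
    { Adj    = λ i j → i ≢ j × y (code i j) ≡ true
    ; sym    = λ {i} {j} (i≢j , yij) → i≢j ∘ sym , trans (cong y (code-sym j i)) yij
    ; irrefl = λ (i≢i , _) → i≢i refl
    }

  independent? : ∀ S → Dec (Independent graph S)
  independent? S = map′ (λ ind {i} {j} → ind i j) (λ ind i j → ind {i} {j})
    (all? λ i → all? λ j → (i ∈ˢ? S) →-dec ((j ∈ˢ? S) →-dec ¬? (¬? (i Fin.≟ j) ×-dec (y (code i j) Bool.≟ true))))

  small-independent : ∀ {s} → (∀ {S} → Unique S → length S ≡ s → ∃ λ c → c ∈ pairs S × y c ≡ true) →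
                      ∀ S → Independent graph S → ∣ S ∣ < s
  small-independent {s} spans S ind = ≰⇒> λ s≤∣S∣ →
    let xs   = elements S
        uniq = Uniqueₚ.take⁺ s (elements-unique S)
        c , c∈ , yc = spans uniq (length-take-≤ s xs (≤-trans s≤∣S∣ (≤-reflexive (sym (length-elements S)))))
        i , j , i∈ , j∈ , i≢j , c≡ = ∈-pairs⁻ uniq c∈
    in ind (∈-elements⁻ S (∈-take s i∈)) (∈-elements⁻ S (∈-take s j∈)) (i≢j , trans (cong y (sym c≡)) yc)

  -- The search for `T` among all subsets is decidable. If it fails, the first Rk′ + 1 elements of
  -- `S` contain a dense `W` of at most m vertices, which `sparse` forbids.
  large-independent : ∀ {R k′ h τ u v m} → 0 < R → 0 < v → τ + u ≡ (suc k′ + 1) * v → 10 * (R * R) < suc k′ →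
    suc k′ ≤ suc h * suc h → v * defect R h + 2 * u ≤ u * suc k′ → R * k′ + 1 ≤ m →
    (∀ {W} → Unique W → 3 ≤ length W → length W ≤ m →
      ¬ τ * length W + 2 * v ≤ 2 * v * length (filterᵇ y (pairs W)) + 2 * τ) →
    AlphaAtLeast graph m (suc R)
  large-independent {R} {k′} {h} {τ} {u} {v} {m} 0<R 0<v τ+u k-large k≤h² u-large size≤m sparse S ∣S∣≡m
    with anySubset? (λ T → (T ⊆? S) ×-dec (independent? T ×-dec (∣ T ∣ ≟ suc R)))
  ... | yes found = found
  ... | no  none  =
    let W , uW , 3≤ , |W|≤ , dense = dense-subset R ≤-refl U (Uniqueₚ.take⁺ size (elements-unique S)) |U| no-indep
    in contradiction (edges W uW dense) (sparse uW 3≤ (≤-trans |W|≤ (≤-trans (≤-reflexive |U|) size≤m)))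
    where
    open Induced y
    open Neighbourhoods adjacent-or-equal nb-refl nb-sym using (HasIndep; cdegSum; module DenseSubset)
    open DenseSubset R k′ h τ u v 0<R 0<v τ+u k-large k≤h² u-large renaming (Dense to IsDense)
    size = R * k′ + 1
    U = take size (elements S)
    |U| : length U ≡ size
    |U| = length-take-≤ size (elements S) (≤-trans size≤m (≤-reflexive (sym (trans (length-elements S) ∣S∣≡m))))
    no-indep : ¬ HasIndep (suc R) U
    no-indep (z , z∈ , indep) = none (fromList zs
      , (λ i∈ → let j , eq = ∈-tabulate⁻ {f = z} (∈-fromList⁻ zs i∈) in subst (_∈ˢ S) (sym eq) (∈-elements⁻ S (∈-take size (z∈ j))))
      , (λ i∈ j∈ (i≢j , yij) → let a , i≡ = ∈-tabulate⁻ {f = z} (∈-fromList⁻ zs i∈)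
                                   b , j≡ = ∈-tabulate⁻ {f = z} (∈-fromList⁻ zs j∈)
                               in nonadjacent i≡ j≡ i≢j yij)
      , trans (∣fromList∣ (Uniqueₚ.tabulate⁺ injective)) (length-tabulate z))
      where
      zs = tabulate z
      injective : ∀ {a b} → z a ≡ z b → a ≡ b
      injective {a} {b} za≡zb with a Fin.≟ b
      ... | yes a≡b = a≡b
      ... | no  a≢b = contradiction (trans (sym (indep a b a≢b)) (trans (cong (λ i → adjacent-or-equal i (z b)) za≡zb) (nb-refl (z b)))) false≢true
      nonadjacent : ∀ {a b i j} → i ≡ z a → j ≡ z b → i ≢ j → ¬ y (code i j) ≡ true
      nonadjacent {a} {b} {i} {j} refl refl i≢j yij with z a Fin.≟ z b | indep a b (λ a≡b → i≢j (cong z a≡b))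
      ... | yes za≡zb | _  = i≢j za≡zb
      ... | no _      | nb = false≢true (trans (sym nb) yij)
    edges : ∀ W → Unique W → IsDense W → τ * length W + 2 * v ≤ 2 * v * length (filterᵇ y (pairs W)) + 2 * τ
    edges W uW dense = ≤-cert 0 (subst (λ d → τ * length W + 2 * v + v * length W ≤ v * d + 2 * τ) (cdegSum-pairs uW) dense)
                                (eq τ v (length W) (length (filterᵇ y (pairs W))))
      where
      eq : ∀ τ v w e → τ * w + 2 * v + (v * (2 * e + w) + 2 * τ) + 0 ≡ 2 * v * e + 2 * τ + (τ * w + 2 * v + v * w)
      eq = solve-∀

-- The premise `k * R < m + R` is the half of k = ⌈m/R⌉ that provides R(k - 1) + 1 vertices in every
-- m-set.
ramsey-graphs : ∀ R k m → 0 < R → 10 * (R * R) + 4 ≤ k → k * R < m + R →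
  ∀ u v → 0 < v → suc (2 * slope R) * suc (2 * slope R) * (v * v) ≤ u * u * (k * 1) → u < (k + 1) * v →
  ∀ a b → 0 < a → 0 < b →
  Σ ℕ λ N → (n : ℕ) → N ≤ n → Σ (Graph n) λ G →
  AlphaAtLeast G m (suc R) × AlphaPowLe G (b * ((k + 1) * v ∸ u)) (v * (2 * b + a))
ramsey-graphs R zero m 0<R k-large = contradiction k-large (<⇒≱ (≤-trans (s≤s z≤n) (m≤n+m 4 (10 * (R * R)))))
ramsey-graphs R (suc k′) m 0<R k-large k-ceil u v 0<v u-bound u< a b 0<a 0<b = N , λ n N≤n →
  let s , (y , sparse , spans) , s-bound = graphs n N≤n
      open PairGraph {n} y
  in graph
   , large-independent {τ = τ} {u = u} 0<R 0<v (m∸n+n≡m {(suc k′ + 1) * v} {u} (<⇒≤ u<)) (<-≤-trans (m<m+n (10 * (R * R)) (s≤s z≤n)) k-large)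
       (≤-trans (<⇒≤ k<) (≤-reflexive (cong (suc h *_) (*-identityʳ (suc h)))))
       (u-large R (suc k′) u v 4≤k u-bound h 1≤h (≤-trans (≤-reflexive (cong (h *_) (sym (*-identityʳ h)))) h²≤k)) size≤m sparse
   , λ S ind → ≤-trans (^-monoˡ-≤ (b * τ) (<⇒≤ (small-independent spans S ind))) s-bound
  where
  τ = (suc k′ + 1) * v ∸ u
  N = proj₁ (sparse-graphs m τ v a b (m<n⇒0<n∸m u<) 0<v 0<a 0<b)
  graphs = proj₂ (sparse-graphs m τ v a b (m<n⇒0<n∸m u<) 0<v 0<a 0<b)
  -- The integer square root of k: h² ≤ k enters `u-large`, and k < (h + 1)² the structural part.
  h = proj₁ (root 2 (s≤s z≤n) (suc k′))
  h²≤k = proj₁ (proj₂ (root 2 (s≤s z≤n) (suc k′)))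
  k< = proj₂ (proj₂ (root 2 (s≤s z≤n) (suc k′)))
  4≤k : 4 ≤ suc k′
  4≤k = ≤-trans (m≤n+m 4 (10 * (R * R))) k-large
  1≤h : 1 ≤ h
  1≤h = n≢0⇒n>0 λ h≡0 → <⇒≱ k< (subst (λ x → suc x ^ 2 ≤ suc k′) (sym h≡0) (s≤s z≤n))
  size≤m : R * k′ + 1 ≤ m
  size≤m = ≤-cert 0 k-ceil (eq R k′ m)
    where
    eq : ∀ R k m → R * k + 1 + (m + R) + 0 ≡ m + (1 + (1 + k) * R)
    eq = solve-∀

-- The fraction u/v ranges over rationals that are at least c₁/(c₂√k), and a/b bounds ε(n) for n ≥
-- N. As `N` may depend on a/b, letting a/b tend to 0 slowly with n yields the function ε.
theorem1p7 : (r : ℕ) → 2 ≤ r →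
    Σ ℕ λ c₁ → Σ ℕ λ c₂ → 0 < c₁ × 0 < c₂ × Σ ℕ λ m₀ →
    (m : ℕ) → m₀ ≤ m →
    (u v : ℕ) → 0 < v →
    c₁ * c₁ * (v * v) ≤ u * u * (ceilDiv m (r ∸ 1) * (c₂ * c₂)) →
    u < (ceilDiv m (r ∸ 1) + 1) * v →
    (a b : ℕ) → 0 < a → 0 < b →
    Σ ℕ λ N → (n : ℕ) → N ≤ n →
    Σ (Graph n) λ G →
    AlphaAtLeast G m r ×
    AlphaPowLe G (b * ((ceilDiv m (r ∸ 1) + 1) * v ∸ u)) (v * (2 * b + a))
theorem1p7 (suc (suc r)) (s≤s (s≤s _)) =
  suc (2 * slope R) , 1 , s≤s z≤n , s≤s z≤n , k₀ * R , λ m m₀≤m →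
    ramsey-graphs R (ceilDiv m R) m (s≤s z≤n)
      (≤-trans (≤-reflexive (sym (m*n/n≡m k₀ R))) (/-monoˡ-≤ R (≤-trans m₀≤m (m≤m+n m r))))
      (≤-<-trans (m/n*n≤m (m + r) R) (+-monoʳ-< m (n<1+n r)))
  where
  R  = suc r
  -- The seeds require k > 10R² and `u-large` requires k ≥ 4; the summand 4 serves both.
  k₀ = 10 * (R * R) + 4
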